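{- Let $0 < \delta < 1 < K$. Then there exist arbitrarily large finite sets $A, B$ in some vector space $V$ over $\mathbb{F}_2$ with the following two properties: (i) $\mathbb{P}(a + b \in A \mid a \in A, b \in B) \geq 1 - \delta$, where $a$ and $b$ are chosen independently and uniformly at random from $A$ and $B$ respectively; equivalently, $|\{(a,b) \in A \times B : a + b \in A\}| \geq (1-\delta)|A||B|$; (ii) there is a constant $C_{K,\delta}$ depending only on $K$ and $\delta$ such that whenever $A' \subset A$ and $B' \subset B$ satisfy $|A' + B'| \leq K|A'|$, we have $|B'| \leq C_{K,\delta} |B|^{1/2}$.
   Context: $A' + B' = \{a + b : a \in A', b \in B'\}$ denotes the sumset. -}

module Defs where

open import Data.Bool using (Bool; _xor_)
import Data.Bool as Bool
open import Data.Nat using (ℕ; _*_; _≤_)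
open import Data.Integer using (+_)
open import Data.Rational using (ℚ; _/_)
open import Data.List using (List; length; filter; cartesianProduct; cartesianProductWith; deduplicate)
open import Data.List.Relation.Unary.All using (All)
open import Data.List.Relation.Unary.Any using (Any)
open import Data.Vec using (Vec; zipWith)
import Data.Vec.Properties as VecP
open import Data.Product using (_×_; _,_; proj₁; proj₂)
open import Relation.Nullary using (Dec)
open import Relation.Binary.Definitions using (DecidableEquality)
open import Relation.Binary.PropositionalEquality using (_≡_)
open import Data.List.Membership.DecPropositional as DecMem using ()

-- The vector space F₂ⁿ, modelled as bit vectors of length n.
-- (Every finite subset of an F₂-vector space lies in a finite-dimensional
--  subspace ≅ F₂ⁿ, so "some vector space V over F₂" = "F₂ⁿ for some n".)
V : ℕ → Set
V n = Vec Bool n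

_⊕_ : ∀ {n} → V n → V n → V n
_⊕_ = zipWith _xor_

_≟V_ : ∀ {n} → DecidableEquality (V n)
_≟V_ = VecP.≡-dec Bool._≟_

_∈_ : ∀ {n} → V n → List (V n) → Set
x ∈ xs = Any (x ≡_) xs

_∈?_ : ∀ {n} (x : V n) (xs : List (V n)) → Dec (x ∈ xs)
x ∈? xs = DecMem._∈?_ _≟V_ x xs

-- finite sets are duplicate-free lists; cardinality = length
-- xs ⊆ ys
_⊆_ : ∀ {n} → List (V n) → List (V n) → Set
xs ⊆ ys = All (_∈ ys) xs

sumset : ∀ {n} → List (V n) → List (V n) → List (V n)
sumset A B = deduplicate _≟V_ (cartesianProductWith _⊕_ A B)

goodPairs : ∀ {n} → List (V n) → List (V n) → ℕ
goodPairs A B = length (filter (λ p → (proj₁ p ⊕ proj₂ p) ∈? A) (cartesianProduct A B))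

ℕ→ℚ : ℕ → ℚ
ℕ→ℚ m = + m / 1

{-# OPTIONS --safe #-}
-- V is the space of m × m bit matrices, B consists of the m² matrix units, and A is a level set of
-- Φ x = Σᵢ g (wtᵢ x), where wtᵢ x is the weight of row i. The increments of g are periodic of period
-- P = M T: over a period they are T, T - 1, …, 1 and then 0. Averaging over the phase θ of the period
-- and the level R gives a level set of which only a fraction 1/M of the moves x ↦ x + b leave.
--
-- If B′ has more than C m elements, many rows contain P of them. Keep P in each such row, and let X ⊆ A.
-- A move is classified by the state of its row, i.e. the number k of ones in the P kept cells and the
-- residue a of the number of ones elsewhere, and by its direction. Double counting shows that X expands
-- if, at most x ∈ X, some class has far more moves out of x than moves back. Otherwise the numbers
-- of rows in the states (a, 0), …, (a, P) are comparable for each a, and by pigeonhole some a has many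
-- rows in all of them. Then for each s = 1, …, T there are many moves at x changing Φ by +s or -s, and as
-- many, up to a factor 2, as moves back. The targets lie on 2T distinct level sets, so they are disjoint
-- and |X + B′| ≥ (T/4) |X|.
module Submission where

-- Sums of natural numbers over lists.

module Sums where

  open import Data.Bool using (Bool; true; false; _∧_)
  open import Data.Nat
  open import Data.Nat.Properties
  open import Data.List using (List; []; _∷_; _++_; map; length; filter; upTo; applyUpTo; cartesianProduct; cartesianProductWith)
  open import Data.List.Membership.Propositional using (_∈_)
  open import Data.List.Membership.Propositional.Properties using (∈-∃++; ∈-++⁻; ∈-++⁺ˡ; ∈-++⁺ʳ)
  open import Data.List.Properties using (length-++)
  open import Data.List.Relation.Unary.All as All using (All)
  open import Data.List.Relation.Unary.Any using (here; there)
  open import Data.List.Relation.Unary.AllPairs using ([]; _∷_)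
  open import Data.List.Relation.Unary.Unique.Propositional using (Unique)
  open import Data.Product using (∃-syntax; _×_; _,_)
  open import Data.Sum using (inj₁; inj₂)
  open import Function using (_∘_)
  open import Level using (0ℓ)
  open import Relation.Binary.PropositionalEquality
  open import Relation.Nullary using (Dec; does; yes; no; ¬_; contradiction)
  open import Relation.Unary using (Pred; Decidable)
  import Algebra.Properties.CommutativeSemigroup +-commutativeSemigroup as +-CS

  ι : Bool → ℕ
  ι false = 0
  ι true  = 1

  ι≤1 : ∀ b → ι b ≤ 1
  ι≤1 false = z≤n
  ι≤1 true  = s≤s z≤n

  ι-∧ : ∀ a b → ι (a ∧ b) ≡ ι a * ι b
  ι-∧ false b = refl
  ι-∧ true  b = sym (*-identityˡ (ι b))

  private variable
    A B C : Set

  ∑ : List A → (A → ℕ) → ℕ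
  ∑ []       f = 0
  ∑ (x ∷ xs) f = f x + ∑ xs f

  ∑-mono∈ : ∀ (xs : List A) {f g : A → ℕ} → (∀ {x} → x ∈ xs → f x ≤ g x) → ∑ xs f ≤ ∑ xs g
  ∑-mono∈ []       f≤g = z≤n
  ∑-mono∈ (x ∷ xs) f≤g = +-mono-≤ (f≤g (here refl)) (∑-mono∈ xs (f≤g ∘ there))

  ∑-mono : ∀ (xs : List A) {f g : A → ℕ} → (∀ x → f x ≤ g x) → ∑ xs f ≤ ∑ xs g
  ∑-mono xs f≤g = ∑-mono∈ xs (λ {x} _ → f≤g x)

  ∑-cong : ∀ (xs : List A) {f g : A → ℕ} → (∀ x → f x ≡ g x) → ∑ xs f ≡ ∑ xs g
  ∑-cong []       f≡g = refl
  ∑-cong (x ∷ xs) f≡g = cong₂ _+_ (f≡g x) (∑-cong xs f≡g)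

  ∑-cong∈ : ∀ (xs : List A) {f g : A → ℕ} → (∀ {x} → x ∈ xs → f x ≡ g x) → ∑ xs f ≡ ∑ xs g
  ∑-cong∈ []       f≡g = refl
  ∑-cong∈ (x ∷ xs) f≡g = cong₂ _+_ (f≡g (here refl)) (∑-cong∈ xs (f≡g ∘ there))

  ∑-+ : ∀ (xs : List A) (f g : A → ℕ) → ∑ xs (λ x → f x + g x) ≡ ∑ xs f + ∑ xs g
  ∑-+ []       f g = refl
  ∑-+ (x ∷ xs) f g = trans (cong (f x + g x +_) (∑-+ xs f g)) (+-CS.interchange (f x) (g x) _ _)

  ∑-*ˡ : ∀ (xs : List A) c (f : A → ℕ) → ∑ xs (λ x → c * f x) ≡ c * ∑ xs f
  ∑-*ˡ []       c f = sym (*-zeroʳ c)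
  ∑-*ˡ (x ∷ xs) c f = trans (cong (c * f x +_) (∑-*ˡ xs c f)) (sym (*-distribˡ-+ c (f x) _))

  ∑-*ʳ : ∀ (xs : List A) c (f : A → ℕ) → ∑ xs (λ x → f x * c) ≡ ∑ xs f * c
  ∑-*ʳ []       c f = refl
  ∑-*ʳ (x ∷ xs) c f = trans (cong (f x * c +_) (∑-*ʳ xs c f)) (sym (*-distribʳ-+ c (f x) _))

  ∑-const : ∀ (xs : List A) c → ∑ xs (λ _ → c) ≡ length xs * c
  ∑-const []       c = refl
  ∑-const (x ∷ xs) c = cong (c +_) (∑-const xs c)

  ∑-zero : ∀ (xs : List A) → ∑ xs (λ _ → 0) ≡ 0
  ∑-zero xs = trans (∑-const xs 0) (*-zeroʳ (length xs))

  ∑-swap : ∀ (xs : List A) (ys : List B) (f : A → B → ℕ) →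
           ∑ xs (λ x → ∑ ys (f x)) ≡ ∑ ys (λ y → ∑ xs (λ x → f x y))
  ∑-swap []       ys f = sym (∑-zero ys)
  ∑-swap (x ∷ xs) ys f = trans (cong (∑ ys (f x) +_) (∑-swap xs ys f)) (sym (∑-+ ys (f x) _))

  ∑-++ : ∀ (xs ys : List A) (f : A → ℕ) → ∑ (xs ++ ys) f ≡ ∑ xs f + ∑ ys f
  ∑-++ []       ys f = refl
  ∑-++ (x ∷ xs) ys f = trans (cong (f x +_) (∑-++ xs ys f)) (sym (+-assoc (f x) _ _))

  ∑-map : ∀ (h : A → B) (xs : List A) (f : B → ℕ) → ∑ (map h xs) f ≡ ∑ xs (f ∘ h)
  ∑-map h []       f = refl
  ∑-map h (x ∷ xs) f = cong (f (h x) +_) (∑-map h xs f)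

  ∑-cartesianProductWith : ∀ (h : A → B → C) (xs : List A) (ys : List B) (f : C → ℕ) →
    ∑ (cartesianProductWith h xs ys) f ≡ ∑ xs (λ x → ∑ ys (λ y → f (h x y)))
  ∑-cartesianProductWith h []       ys f = refl
  ∑-cartesianProductWith h (x ∷ xs) ys f =
    trans (∑-++ (map (h x) ys) _ f) (cong₂ _+_ (∑-map (h x) ys f) (∑-cartesianProductWith h xs ys f))

  ∈⇒≤∑ : ∀ {xs : List A} {x} (f : A → ℕ) → x ∈ xs → f x ≤ ∑ xs f
  ∈⇒≤∑ f (here refl) = m≤m+n _ _
  ∈⇒≤∑ f (there x∈)  = ≤-trans (∈⇒≤∑ f x∈) (m≤n+m _ _)

  length-filter≡∑ : ∀ {P : Pred A 0ℓ} (P? : Decidable P) (xs : List A) →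
                    length (filter P? xs) ≡ ∑ xs (λ x → ι (does (P? x)))
  length-filter≡∑ P? []       = refl
  length-filter≡∑ P? (x ∷ xs) with P? x
  ... | yes _ = cong suc (length-filter≡∑ P? xs)
  ... | no  _ = length-filter≡∑ P? xs

  ∑-single : ∀ {xs : List A} {a} (f : A → ℕ) → Unique xs → a ∈ xs → (∀ x → x ≢ a → f x ≡ 0) → ∑ xs f ≡ f a
  ∑-single {xs = x ∷ xs} f (x∉ ∷ _) (here refl) f0 =
    trans (cong (f x +_) (n≤0⇒n≡0 (≤-trans (∑-mono∈ xs (λ y∈ → ≤-reflexive (f0 _ (λ y≡x → All.lookup x∉ y∈ (sym y≡x)))))
                                            (≤-reflexive (∑-zero xs)))))
          (+-identityʳ (f x))
  ∑-single {xs = x ∷ xs} f (x∉ ∷ u) (there a∈) f0 =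
    trans (cong (_+ ∑ xs f) (f0 x (All.lookup x∉ a∈))) (∑-single f u a∈ f0)

  ∑-atMostOne : ∀ {xs : List A} (p : A → Bool) → Unique xs → (∀ x y → p x ≡ true → p y ≡ true → x ≡ y) →
                ∑ xs (λ x → ι (p x)) ≤ 1
  ∑-atMostOne {xs = []}     p u         inj = z≤n
  ∑-atMostOne {xs = x ∷ xs} p (x∉ ∷ u) inj with p x in px
  ... | false = ∑-atMostOne p u inj
  ... | true  = s≤s (≤-trans (∑-mono∈ xs zero-on) (≤-reflexive (∑-zero xs)))
    where
    zero-on : ∀ {y} → y ∈ xs → ι (p y) ≤ 0
    zero-on {y} y∈ with p y in py
    ... | false = z≤n
    ... | true  = contradiction (inj x y px py) (All.lookup x∉ y∈)

  average : ∀ (xs : List A) (f g : A → ℕ) → ∑ xs f ≤ ∑ xs g → 0 < ∑ xs g →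
            ∃[ x ] x ∈ xs × f x ≤ g x × 0 < g x
  average (x ∷ xs) f g F≤G 0<G with f x ≤? g x | 0 <? g x
  ... | yes fx≤gx | yes 0<gx = x , here refl , fx≤gx , 0<gx
  ... | yes fx≤gx | no  0≮gx with average xs f g (subst (λ k → ∑ xs f ≤ k + ∑ xs g) gx≡0 (m+n≤o⇒n≤o (f x) F≤G))
                                            (subst (λ k → 0 < k + ∑ xs g) gx≡0 0<G)
    where
    gx≡0 : g x ≡ 0
    gx≡0 = n≤0⇒n≡0 (≮⇒≥ 0≮gx)
  ...   | y , y∈ , r = y , there y∈ , r
  average (x ∷ xs) f g F≤G 0<G | no fx≰gx | _ with average xs f g (<⇒≤ F<G) (≤-<-trans z≤n F<G)
    where
    F<G : ∑ xs f < ∑ xs g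
    F<G = +-cancelˡ-< (g x) _ _ (<-≤-trans (+-monoˡ-< _ (≰⇒> fx≰gx)) F≤G)
  ... | y , y∈ , r = y , there y∈ , r

  Unique-⊆⇒length≤ : ∀ {xs ys : List A} → Unique xs → (∀ {x} → x ∈ xs → x ∈ ys) → length xs ≤ length ys
  Unique-⊆⇒length≤ {xs = []}     u         xs⊆ = z≤n
  Unique-⊆⇒length≤ {xs = x ∷ xs} (x∉ ∷ u) xs⊆ with ∈-∃++ (xs⊆ (here refl))
  ... | ls , rs , refl = subst (suc (length xs) ≤_) (sym eq) (s≤s (Unique-⊆⇒length≤ u sub))
    where
    eq : length (ls ++ x ∷ rs) ≡ suc (length (ls ++ rs))
    eq = trans (length-++ ls) (trans (+-suc (length ls) (length rs)) (cong suc (sym (length-++ ls))))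
    sub : ∀ {y} → y ∈ xs → y ∈ ls ++ rs
    sub y∈ with ∈-++⁻ ls (xs⊆ (there y∈))
    ... | inj₁ y∈ls         = ∈-++⁺ˡ y∈ls
    ... | inj₂ (here refl)  = contradiction refl (All.lookup x∉ y∈)
    ... | inj₂ (there y∈rs) = ∈-++⁺ʳ ls y∈rs

  ∑-upTo-suc : ∀ n (f : ℕ → ℕ) → ∑ (upTo (suc n)) f ≡ f 0 + ∑ (upTo n) (f ∘ suc)
  ∑-upTo-suc n f = cong (f 0 +_) (shift n (λ x → x))
    where
    shift : ∀ n (h : ℕ → ℕ) → ∑ (applyUpTo (suc ∘ h) n) f ≡ ∑ (applyUpTo h n) (f ∘ suc)
    shift zero    h = refl
    shift (suc n) h = cong (f (suc (h 0)) +_) (shift n (h ∘ suc))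

  ∑-upTo-last : ∀ n (f : ℕ → ℕ) → ∑ (upTo (suc n)) f ≡ ∑ (upTo n) f + f n
  ∑-upTo-last zero    f = +-comm (f 0) 0
  ∑-upTo-last (suc n) f = begin
    ∑ (upTo (suc (suc n))) f              ≡⟨ ∑-upTo-suc (suc n) f ⟩
    f 0 + ∑ (upTo (suc n)) (f ∘ suc)      ≡⟨ cong (f 0 +_) (∑-upTo-last n (f ∘ suc)) ⟩
    f 0 + (∑ (upTo n) (f ∘ suc) + f (suc n)) ≡⟨ +-assoc (f 0) _ _ ⟨
    f 0 + ∑ (upTo n) (f ∘ suc) + f (suc n) ≡⟨ cong (_+ f (suc n)) (∑-upTo-suc n f) ⟨
    ∑ (upTo (suc n)) f + f (suc n)        ∎
    where open ≡-Reasoning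

  ∑-upTo-cong : ∀ n {f g : ℕ → ℕ} → (∀ i → i < n → f i ≡ g i) → ∑ (upTo n) f ≡ ∑ (upTo n) g
  ∑-upTo-cong zero    f≡g = refl
  ∑-upTo-cong (suc n) {f} {g} f≡g =
    trans (∑-upTo-suc n f) (trans (cong₂ _+_ (f≡g 0 (s≤s z≤n)) (∑-upTo-cong n (λ i i<n → f≡g (suc i) (s≤s i<n))))
          (sym (∑-upTo-suc n g)))

  -- Moving the window by one drops `f w` and gains `f (w + P)`, which are equal.
  ∑-periodic : ∀ P (f : ℕ → ℕ) → (∀ i → f (i + P) ≡ f i) → ∀ w →
               ∑ (upTo P) (λ θ → f (w + θ)) ≡ ∑ (upTo P) f
  ∑-periodic P f per zero    = refl
  ∑-periodic P f per (suc w) = trans (+-cancelˡ-≡ (f w) _ _ step) (∑-periodic P f per w)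
    where
    open ≡-Reasoning
    step : f w + ∑ (upTo P) (λ θ → f (suc w + θ)) ≡ f w + ∑ (upTo P) (λ θ → f (w + θ))
    step = begin
      f w + ∑ (upTo P) (λ θ → f (suc w + θ))         ≡⟨ cong₂ _+_ (cong f (sym (+-identityʳ w)))
                                                           (∑-cong (upTo P) (λ θ → cong f (sym (+-suc w θ)))) ⟩
      f (w + 0) + ∑ (upTo P) (λ θ → f (w + suc θ))   ≡⟨ ∑-upTo-suc P (λ θ → f (w + θ)) ⟨
      ∑ (upTo (suc P)) (λ θ → f (w + θ))             ≡⟨ ∑-upTo-last P (λ θ → f (w + θ)) ⟩
      ∑ (upTo P) (λ θ → f (w + θ)) + f (w + P)       ≡⟨ cong (∑ (upTo P) (λ θ → f (w + θ)) +_) (per w) ⟩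
      ∑ (upTo P) (λ θ → f (w + θ)) + f w             ≡⟨ +-comm _ (f w) ⟩
      f w + ∑ (upTo P) (λ θ → f (w + θ))             ∎

  ∑-upTo-< : ∀ {T P} → T ≤ P → ∑ (upTo P) (λ i → ι (i <ᵇ T)) ≡ T
  ∑-upTo-< {zero}  {P}     _         = ∑-zero (upTo P)
  ∑-upTo-< {suc T} {suc P} (s≤s T≤P) = trans (∑-upTo-suc P (λ i → ι (i <ᵇ suc T))) (cong suc (∑-upTo-< T≤P))

-- The cube `F₂ⁿ`, bit matrices and the potential `Φ`.

module Cube where

  open import Data.Bool using (Bool; true; false; not; _∧_; _xor_)
  open import Data.Bool.Properties using (xor-identityʳ)
  open import Data.Fin using (Fin; zero; suc; combine)
  import Data.Fin as Fin
  open import Data.Fin.Properties using (combine-injective)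
  open import Data.Nat
  open import Data.Nat.Properties
  open import Data.List using (List; []; _∷_; _++_; map; allFin)
  open import Data.List.Membership.Propositional using (_∈_)
  open import Data.List.Membership.Propositional.Properties
    using (∈-++⁺ˡ; ∈-++⁺ʳ; ∈-map⁺; ∈-map⁻; ∈-allFin)
  open import Data.List.Relation.Unary.AllPairs using ([]; _∷_)
  open import Data.List.Relation.Unary.All using ([])
  open import Data.List.Relation.Unary.Any using (here)
  open import Data.List.Relation.Unary.Unique.Propositional using (Unique)
  open import Data.List.Relation.Unary.Unique.Propositional.Properties using (map⁺; ++⁺; allFin⁺)
  open import Data.Product using (∃-syntax; _×_; _,_; proj₁; proj₂)
  open import Data.Vec using (Vec; []; _∷_; lookup; replicate; _[_]≔_)
  open import Data.Vec.Properties using (∷-injectiveʳ; lookup-zipWith; lookup∘update; lookup∘update′; lookup-replicate)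
  open import Function using (_∘_; const)
  open import Relation.Binary.PropositionalEquality
  open import Relation.Nullary using (does; yes; no; contradiction)
  open import Defs using (V; _⊕_)
  open Sums

  allV : ∀ n → List (V n)
  allV zero    = [] ∷ []
  allV (suc n) = map (false ∷_) (allV n) ++ map (true ∷_) (allV n)

  ∈-allV : ∀ {n} (x : V n) → x ∈ allV n
  ∈-allV []          = here refl
  ∈-allV (false ∷ x) = ∈-++⁺ˡ (∈-map⁺ (false ∷_) (∈-allV x))
  ∈-allV (true  ∷ x) = ∈-++⁺ʳ (map (false ∷_) (allV _)) (∈-map⁺ (true ∷_) (∈-allV x))

  allV-unique : ∀ n → Unique (allV n)
  allV-unique zero    = [] ∷ []
  allV-unique (suc n) = ++⁺ (map⁺ ∷-injectiveʳ (allV-unique n)) (map⁺ ∷-injectiveʳ (allV-unique n))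
    λ { (p , q) → disjoint (∈-map⁻ (false ∷_) p) (∈-map⁻ (true ∷_) q) }
    where
    open import Data.Empty using (⊥)
    disjoint : ∀ {v : V (suc n)} → ∃[ x ] x ∈ allV n × v ≡ false ∷ x → ∃[ y ] y ∈ allV n × v ≡ true ∷ y → ⊥
    disjoint (_ , _ , refl) (_ , _ , ())

  -- By induction on the bits: the first bit of `e` at most exchanges the two halves of the cube.
  ∑-translate : ∀ {n} (e : V n) (f : V n → ℕ) → ∑ (allV n) (λ x → f (x ⊕ e)) ≡ ∑ (allV n) f
  ∑-translate []      f = refl
  ∑-translate {suc n} (b ∷ e) f = begin
    ∑ (map (false ∷_) xs ++ map (true ∷_) xs) (λ x → f (x ⊕ (b ∷ e)))
      ≡⟨ split (λ x → f (x ⊕ (b ∷ e))) ⟩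
    ∑ xs (λ x → f (b ∷ (x ⊕ e))) + ∑ xs (λ x → f (not b ∷ (x ⊕ e)))
      ≡⟨ cong₂ _+_ (∑-translate e (f ∘ (b ∷_))) (∑-translate e (f ∘ (not b ∷_))) ⟩
    ∑ xs (f ∘ (b ∷_)) + ∑ xs (f ∘ (not b ∷_))
      ≡⟨ reorder b ⟩
    ∑ xs (f ∘ (false ∷_)) + ∑ xs (f ∘ (true ∷_))
      ≡⟨ split f ⟨
    ∑ (map (false ∷_) xs ++ map (true ∷_) xs) f ∎
    where
    open ≡-Reasoning
    xs = allV n
    split : ∀ (h : V (suc n) → ℕ) →
            ∑ (map (false ∷_) xs ++ map (true ∷_) xs) h ≡ ∑ xs (h ∘ (false ∷_)) + ∑ xs (h ∘ (true ∷_))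
    split h = trans (∑-++ (map (false ∷_) xs) _ h) (cong₂ _+_ (∑-map (false ∷_) xs h) (∑-map (true ∷_) xs h))
    reorder : ∀ b → ∑ xs (f ∘ (b ∷_)) + ∑ xs (f ∘ (not b ∷_)) ≡ ∑ xs (f ∘ (false ∷_)) + ∑ xs (f ∘ (true ∷_))
    reorder false = refl
    reorder true  = +-comm (∑ xs (f ∘ (true ∷_))) _

  ⊕-cancel : ∀ {n} (x e : V n) → (x ⊕ e) ⊕ e ≡ x
  ⊕-cancel []      []      = refl
  ⊕-cancel (a ∷ x) (b ∷ e) = cong₂ _∷_ (xor-cancel a b) (⊕-cancel x e)
    where
    xor-cancel : ∀ a b → (a xor b) xor b ≡ a
    xor-cancel false false = refl
    xor-cancel false true  = refl
    xor-cancel true  false = refl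
    xor-cancel true  true  = refl

  ⊕-cancelˡ : ∀ {n} (x : V n) {y z : V n} → x ⊕ y ≡ x ⊕ z → y ≡ z
  ⊕-cancelˡ []      {[]}    {[]}    _ = refl
  ⊕-cancelˡ (a ∷ x) {b ∷ y} {c ∷ z} p = cong₂ _∷_ (xor-cancelˡ a b c (cong head p)) (⊕-cancelˡ x (∷-injectiveʳ p))
    where
    open import Data.Vec using (head)
    xor-cancelˡ : ∀ a b c → a xor b ≡ a xor c → b ≡ c
    xor-cancelˡ false b     c     p = p
    xor-cancelˡ true  false false p = refl
    xor-cancelˡ true  true  true  p = refl

  -- F₂^(m·m) is viewed as the space of m × m bit matrices.
  module Grid (m : ℕ) where

    unit : Fin m × Fin m → V (m * m)
    unit (i , j) = replicate (m * m) false [ combine i j ]≔ true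

    flip : V (m * m) → Fin m × Fin m → V (m * m)
    flip x p = x ⊕ unit p

    bit : V (m * m) → Fin m → Fin m → Bool
    bit x i j = lookup x (combine i j)

    flip-flip : ∀ x p → flip (flip x p) p ≡ x
    flip-flip x p = ⊕-cancel x (unit p)

    bit-flip-same : ∀ x i j → bit (flip x (i , j)) i j ≡ not (bit x i j)
    bit-flip-same x i j = trans (lookup-zipWith _xor_ (combine i j) x (unit (i , j)))
      (trans (cong (bit x i j xor_) (lookup∘update (combine i j) (replicate (m * m) false) true)) (xor-true _))
      where
      xor-true : ∀ b → b xor true ≡ not b
      xor-true false = refl
      xor-true true  = refl

    bit-flip-other : ∀ x {i j i′ j′} → (i′ , j′) ≢ (i , j) → bit (flip x (i , j)) i′ j′ ≡ bit x i′ j′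
    bit-flip-other x {i} {j} {i′} {j′} ne = trans (lookup-zipWith _xor_ (combine i′ j′) x (unit (i , j)))
      (trans (cong (bit x i′ j′ xor_) (trans (lookup∘update′ ne′ (replicate (m * m) false) true)
                                              (lookup-replicate (combine i′ j′) false)))
             (xor-identityʳ _))
      where
      ne′ : combine i′ j′ ≢ combine i j
      ne′ eq with combine-injective i′ j′ i j eq
      ... | refl , refl = ne refl

    unit-injective : ∀ {p q} → unit p ≡ unit q → p ≡ q
    unit-injective {i , j} {i′ , j′} eq with combine i j Fin.≟ combine i′ j′
    ... | yes c≡ with combine-injective i j i′ j′ c≡
    ...   | refl , refl = refl
    unit-injective {i , j} {i′ , j′} eq | no c≢ = contradiction
      (trans (sym (lookup∘update (combine i j) (replicate (m * m) false) true))
        (trans (cong (λ v → lookup v (combine i j)) eq)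
          (trans (lookup∘update′ c≢ (replicate (m * m) false) true) (lookup-replicate (combine i j) false))))
      λ ()

    cnt : (Fin m → Bool) → V (m * m) → Fin m → ℕ
    cnt w x i = ∑ (allFin m) (λ j → ι (w j ∧ bit x i j))

    cnt-flip-other : ∀ w x {i j i′} → i′ ≢ i → cnt w (flip x (i , j)) i′ ≡ cnt w x i′
    cnt-flip-other w x i′≢i = ∑-cong (allFin m) λ j′ →
      cong (λ b → ι (w j′ ∧ b)) (bit-flip-other x (i′≢i ∘ cong proj₁))

    cnt-flip-up : ∀ w x {i j} → w j ≡ true → bit x i j ≡ false → cnt w (flip x (i , j)) i ≡ suc (cnt w x i)
    cnt-flip-up w x {i} {j} wj xj = begin
      cnt w (flip x (i , j)) i                                   ≡⟨ ∑-cong (allFin m) pointwise ⟩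
      ∑ (allFin m) (λ j′ → ι (does (j′ Fin.≟ j)) + ι (w j′ ∧ bit x i j′)) ≡⟨ ∑-+ (allFin m) _ _ ⟩
      ∑ (allFin m) (λ j′ → ι (does (j′ Fin.≟ j))) + cnt w x i    ≡⟨ cong (_+ cnt w x i) one ⟩
      suc (cnt w x i)                                            ∎
      where
      open ≡-Reasoning
      pointwise : ∀ j′ → ι (w j′ ∧ bit (flip x (i , j)) i j′) ≡ ι (does (j′ Fin.≟ j)) + ι (w j′ ∧ bit x i j′)
      pointwise j′ with j′ Fin.≟ j
      ... | yes refl rewrite bit-flip-same x i j | xj | wj = refl
      ... | no  ne   rewrite bit-flip-other x {i} {j} {i} {j′} (ne ∘ cong proj₂) = refl
      δ : Fin m → ℕ
      δ j′ = ι (does (j′ Fin.≟ j))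
      δ-off : ∀ j′ → j′ ≢ j → δ j′ ≡ 0
      δ-off j′ ne with j′ Fin.≟ j
      ... | yes eq = contradiction eq ne
      ... | no  _  = refl
      δ-on : δ j ≡ 1
      δ-on with j Fin.≟ j
      ... | yes _ = refl
      ... | no ne = contradiction refl ne
      one : ∑ (allFin m) δ ≡ 1
      one = trans (∑-single δ (allFin⁺ m) (∈-allFin j) δ-off) δ-on

    wt : V (m * m) → Fin m → ℕ
    wt = cnt (const true)

    -- When a row of weight w gains a one, g grows by h w = T ∸ ((w + θ) % P), which vanishes for
    -- all but a fraction T / P of the residues and otherwise takes the distinct values 1, …, T.
    module Potential (P : ℕ) .{{_ : NonZero P}} (T θ : ℕ) where

      h : ℕ → ℕ
      h w = T ∸ (w + θ) % P

      g : ℕ → ℕ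
      g zero    = 0
      g (suc w) = g w + h w

      Φ : V (m * m) → ℕ
      Φ x = ∑ (allFin m) (λ i → g (wt x i))

      -- Only row `i` changes, its weight grows by one, and `h` is the increment of `g`.
      Φ-flip-up : ∀ x {i j} → bit x i j ≡ false → Φ (flip x (i , j)) ≡ Φ x + h (wt x i)
      Φ-flip-up x {i} {j} xij = begin
        Φ (flip x (i , j))                    ≡⟨ ∑-cong (allFin m) pointwise ⟩
        ∑ (allFin m) (λ i′ → g (wt x i′) + d i′) ≡⟨ ∑-+ (allFin m) _ d ⟩
        Φ x + ∑ (allFin m) d                  ≡⟨ cong (Φ x +_) (∑-single d (allFin⁺ m) (∈-allFin i) d-off) ⟩
        Φ x + d i                             ≡⟨ cong (Φ x +_) d-on ⟩
        Φ x + h (wt x i)                      ∎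
        where
        open ≡-Reasoning
        d : Fin m → ℕ
        d i′ = ι (does (i′ Fin.≟ i)) * h (wt x i)
        d-off : ∀ i′ → i′ ≢ i → d i′ ≡ 0
        d-off i′ ne with i′ Fin.≟ i
        ... | yes eq = contradiction eq ne
        ... | no  _  = refl
        d-on : d i ≡ h (wt x i)
        d-on with i Fin.≟ i
        ... | yes _ = +-identityʳ _
        ... | no ne = contradiction refl ne
        pointwise : ∀ i′ → g (wt (flip x (i , j)) i′) ≡ g (wt x i′) + d i′
        pointwise i′ with i′ Fin.≟ i
        ... | yes refl rewrite cnt-flip-up (const true) x {i} {j} refl xij = cong (g (wt x i) +_) (sym (+-identityʳ _))
        ... | no  ne   rewrite cnt-flip-other (const true) x {i} {j} ne = sym (+-identityʳ _)

-- An almost invariant level set, by averaging over phases and levels.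

module LevelSet where

  open import Data.Bool as Bool using (Bool; true; false; not; if_then_else_)
  open import Data.Fin using (Fin)
  open import Data.Nat
  open import Data.Nat.Properties
  open import Data.Nat.DivMod using ([m+n]%n≡m%n; m<n⇒m%n≡m)
  open import Data.List using (List; []; _∷_; map; filter; length; allFin; upTo; cartesianProduct)
  open import Data.List.Properties using (length-tabulate; length-upTo)
  open import Data.List.Membership.Propositional using (_∈_)
  open import Data.List.Membership.Propositional.Properties using (∈-filter⁺; ∈-filter⁻; ∈-upTo⁺)
  open import Data.List.Relation.Unary.Unique.Propositional.Properties using (upTo⁺)
  open import Data.Product using (∃-syntax; _×_; _,_; proj₂)
  open import Function using (_∘_; id)
  open import Level using (0ℓ)
  open import Relation.Binary.PropositionalEquality
  open import Relation.Nullary using (Dec; does; yes; no; ¬_; contradiction)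
  open import Relation.Unary using (Pred; Decidable)
  open import Data.Vec using (replicate)
  open import Defs using (V; _⊕_; goodPairs; _∈?_)
  open Sums
  open Cube

  ι-yes : ∀ {A : Set} (d : Dec A) → A → ι (does d) ≡ 1
  ι-yes (yes _) a = refl
  ι-yes (no ¬a) a = contradiction a ¬a

  ι-no : ∀ {A : Set} (d : Dec A) → ¬ A → ι (does d) ≡ 0
  ι-no (yes a) ¬a = contradiction a ¬a
  ι-no (no _)  ¬a = refl

  ι-not≤ : ∀ {A : Set} (d : Dec A) {b} → (b ≡ false → A) → ι (not (does d)) ≤ ι b
  ι-not≤ (yes _)         f = z≤n
  ι-not≤ (no _)  {true}  f = ≤-refl
  ι-not≤ (no ¬a) {false} f = contradiction (f refl) ¬a

  ι-complement : ∀ {A B : Set} (d : Dec A) (e : Dec B) → (A → B) → (B → A) → ι (does d) + ι (not (does e)) ≡ 1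
  ι-complement (yes a) (yes b) _ _ = refl
  ι-complement (no ¬a) (no ¬b) _ _ = refl
  ι-complement (yes a) (no ¬b) f _ = contradiction (f a) ¬b
  ι-complement (no ¬a) (yes b) _ g = contradiction (g b) ¬a

  ∑-filter : ∀ {A : Set} {P : Pred A 0ℓ} (P? : Decidable P) (xs : List A) (f : A → ℕ) →
             ∑ (filter P? xs) f ≡ ∑ xs (λ x → ι (does (P? x)) * f x)
  ∑-filter P? []       f = refl
  ∑-filter P? (x ∷ xs) f with P? x
  ... | yes _ = cong₂ _+_ (sym (*-identityˡ (f x))) (∑-filter P? xs f)
  ... | no  _ = ∑-filter P? xs f

  cells : ∀ m → List (Fin m × Fin m)
  cells m = cartesianProduct (allFin m) (allFin m)

  length-cells : ∀ m → length (cells m) ≡ m * m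
  length-cells m = begin
    length (cells m)                             ≡⟨ *-identityʳ _ ⟨
    length (cells m) * 1                         ≡⟨ ∑-const (cells m) 1 ⟨
    ∑ (cells m) (λ _ → 1)                        ≡⟨ ∑-cartesianProductWith _,_ (allFin m) (allFin m) _ ⟩
    ∑ (allFin m) (λ _ → ∑ (allFin m) (λ _ → 1))  ≡⟨ ∑-const (allFin m) _ ⟩
    length (allFin m) * ∑ (allFin m) (λ _ → 1)   ≡⟨ cong₂ _*_ (length-tabulate {n = m} id)
                                                      (trans (∑-const (allFin m) 1) (trans (*-identityʳ _) (length-tabulate {n = m} id))) ⟩
    m * m                                        ∎
    where open ≡-Reasoning

  -- Each x lies on exactly one level set of each Φ θ, so summing over (θ, R) counts every pair
  -- (x, p) once per θ, and at most T of the M * T values of θ see a change.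
  module Averaging {n : ℕ} {I : Set} (cells : List I) (unit : I → V n) (Φ : ℕ → V n → ℕ) (M T : ℕ) where

    P = M * T
    N = length cells

    B : List (V n)
    B = map unit cells

    level : ℕ → ℕ → List (V n)
    level θ R = filter (λ x → Φ θ x ≟ R) (allV n)

    changed : ℕ → V n → I → ℕ
    changed θ x p = ι (not (does (Φ θ (x ⊕ unit p) ≟ Φ θ x)))

    -- Exceeds every value `Φ θ x` with `θ < P` at once, so that one range of levels serves all
    -- phases. The sum of all values stands in for their maximum.
    bound : ℕ
    bound = suc (∑ (upTo P) (λ θ → ∑ (allV n) (Φ θ)))

    on-level : ℕ → ℕ → V n → ℕ
    on-level θ R x = ι (does (Φ θ x ≟ R))

    ∑-on-level : ∀ {θ} → θ ∈ upTo P → ∀ x → ∑ (upTo bound) (λ R → on-level θ R x) ≡ 1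
    ∑-on-level {θ} θ∈ x = trans
      (∑-single (λ R → on-level θ R x) (upTo⁺ bound) (∈-upTo⁺ Φ<bound) (λ R R≢ → ι-no (Φ θ x ≟ R) (R≢ ∘ sym)))
      (ι-yes (Φ θ x ≟ Φ θ x) refl)
      where
      Φ<bound : Φ θ x < bound
      Φ<bound = s≤s (≤-trans (∈⇒≤∑ (Φ θ) (∈-allV x)) (∈⇒≤∑ (λ θ → ∑ (allV n) (Φ θ)) θ∈))

    ∑-levels : ∀ (F : ℕ → V n → ℕ) →
      ∑ (cartesianProduct (upTo P) (upTo bound)) (λ (θ , R) → ∑ (level θ R) (F θ)) ≡
      ∑ (upTo P) (λ θ → ∑ (allV n) (F θ))
    ∑-levels F = trans (∑-cartesianProductWith _,_ (upTo P) (upTo bound) _)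
      (∑-upTo-cong P λ θ θ<P → begin
        ∑ (upTo bound) (λ R → ∑ (level θ R) (F θ))
          ≡⟨ ∑-cong (upTo bound) (λ R → ∑-filter (λ x → Φ θ x ≟ R) (allV n) (F θ)) ⟩
        ∑ (upTo bound) (λ R → ∑ (allV n) (λ x → on-level θ R x * F θ x))
          ≡⟨ ∑-swap (upTo bound) (allV n) _ ⟩
        ∑ (allV n) (λ x → ∑ (upTo bound) (λ R → on-level θ R x * F θ x))
          ≡⟨ ∑-cong (allV n) (λ x → trans (∑-*ʳ (upTo bound) (F θ x) (λ R → on-level θ R x))
               (trans (cong (_* F θ x) (∑-on-level (∈-upTo⁺ θ<P) x)) (*-identityˡ _))) ⟩
        ∑ (allV n) (F θ) ∎)
      where open ≡-Reasoning

    -- Summed over a level set of `Φ θ`, the inequality `F ≤ G` says that at most a fraction `1 / M`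
    -- of the moves change `Φ θ`.
    F G : ℕ → V n → ℕ
    F θ x = M * ∑ cells (changed θ x)
    G θ x = N

    ∑F≤ : (∀ x p → ∑ (upTo P) (λ θ → changed θ x p) ≤ T) →
          ∑ (upTo P) (λ θ → ∑ (allV n) (F θ)) ≤ ∑ (upTo P) (λ θ → ∑ (allV n) (G θ))
    ∑F≤ ∑-changed≤ = begin
      ∑ (upTo P) (λ θ → ∑ (allV n) (F θ))
        ≡⟨ ∑-swap (upTo P) (allV n) F ⟩
      ∑ (allV n) (λ x → ∑ (upTo P) (λ θ → F θ x))
        ≤⟨ ∑-mono (allV n) per-vector ⟩
      ∑ (allV n) (λ x → ∑ (upTo P) (λ θ → G θ x))
        ≡⟨ ∑-swap (upTo P) (allV n) G ⟨
      ∑ (upTo P) (λ θ → ∑ (allV n) (G θ)) ∎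
      where
      open ≤-Reasoning
      per-vector : ∀ x → ∑ (upTo P) (λ θ → F θ x) ≤ ∑ (upTo P) (λ θ → G θ x)
      per-vector x = begin
        ∑ (upTo P) (λ θ → M * ∑ cells (changed θ x)) ≡⟨ ∑-*ˡ (upTo P) M _ ⟩
        M * ∑ (upTo P) (λ θ → ∑ cells (changed θ x)) ≡⟨ cong (M *_) (∑-swap (upTo P) cells _) ⟩
        M * ∑ cells (λ p → ∑ (upTo P) (λ θ → changed θ x p)) ≤⟨ *-monoʳ-≤ M (∑-mono cells (∑-changed≤ x)) ⟩
        M * ∑ cells (λ p → T)                        ≡⟨ cong (M *_) (trans (∑-const cells T) (*-comm N T)) ⟩
        M * (T * N)                                      ≡⟨ *-assoc M T N ⟨
        P * N                                            ≡⟨ cong (_* N) (length-upTo P) ⟨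
        length (upTo P) * N                              ≡⟨ ∑-const (upTo P) N ⟨
        ∑ (upTo P) (λ θ → N)                             ∎

    0<∑G : 0 < P → 0 < N → 0 < ∑ (upTo P) (λ θ → ∑ (allV n) (G θ))
    0<∑G 0<P 0<N = <-≤-trans 0<N (≤-trans (∈⇒≤∑ (λ _ → N) (∈-allV (replicate n false)))
                                      (∈⇒≤∑ (λ θ → ∑ (allV n) (G θ)) (∈-upTo⁺ 0<P)))

    averaged : (∀ x p → ∑ (upTo P) (λ θ → changed θ x p) ≤ T) → 0 < P → 0 < N → ∃[ θ ] ∃[ R ] M * ∑ (level θ R) (λ x → ∑ cells (changed θ x)) ≤ length (level θ R) * N
                                  × 0 < length (level θ R) * N
    averaged ∑-changed≤ 0<P 0<N with average (cartesianProduct (upTo P) (upTo bound))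
      (λ (θ , R) → ∑ (level θ R) (F θ)) (λ (θ , R) → ∑ (level θ R) (G θ))
      (subst₂ _≤_ (sym (∑-levels F)) (sym (∑-levels G)) (∑F≤ ∑-changed≤))
      (subst (0 <_) (sym (∑-levels G)) (0<∑G 0<P 0<N))
    ... | (θ , R) , _ , F≤G , 0<G = θ , R , subst₂ _≤_ (∑-*ˡ (level θ R) M _) (∑-const (level θ R) N) F≤G
                                          , subst (0 <_) (∑-const (level θ R) N) 0<G

    goodPairs-level : ∀ θ R → goodPairs (level θ R) B ≡
      ∑ (level θ R) (λ x → ∑ cells (λ p → ι (does ((x ⊕ unit p) ∈? level θ R))))
    goodPairs-level θ R = trans (length-filter≡∑ _ (cartesianProduct (level θ R) B))
      (trans (∑-cartesianProductWith _,_ (level θ R) B _)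
             (∑-cong (level θ R) (λ x → ∑-map unit cells _)))

    -- A move from a point of the level set stays in it exactly when it preserves `Φ θ`.
    good+changed : ∀ θ R → goodPairs (level θ R) B + ∑ (level θ R) (λ x → ∑ cells (changed θ x)) ≡
                           length (level θ R) * N
    good+changed θ R = begin
      goodPairs A B + ∑ A (λ x → ∑ cells (changed θ x))
        ≡⟨ cong (_+ ∑ A (λ x → ∑ cells (changed θ x))) (goodPairs-level θ R) ⟩
      ∑ A (λ x → ∑ cells (stays x)) + ∑ A (λ x → ∑ cells (changed θ x))
        ≡⟨ ∑-+ A _ _ ⟨
      ∑ A (λ x → ∑ cells (stays x) + ∑ cells (changed θ x))
        ≡⟨ ∑-cong∈ A (λ {x} x∈ → trans (sym (∑-+ cells (stays x) (changed θ x)))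
             (trans (∑-cong cells (stays+changed x∈)) (trans (∑-const cells 1) (*-identityʳ N)))) ⟩
      ∑ A (λ _ → N)
        ≡⟨ ∑-const A N ⟩
      length A * N ∎
      where
      open ≡-Reasoning
      A = level θ R
      stays : V n → I → ℕ
      stays x p = ι (does ((x ⊕ unit p) ∈? A))
      stays+changed : ∀ {x} → x ∈ A → ∀ p → stays x p + changed θ x p ≡ 1
      stays+changed {x} x∈ p = ι-complement ((x ⊕ unit p) ∈? A) (Φ θ ((x ⊕ unit p)) ≟ Φ θ x)
        (λ y∈ → trans (proj₂ (∈-filter⁻ Φ≟R {xs = allV n} y∈)) (sym Φx≡R))
        (λ same → ∈-filter⁺ Φ≟R (∈-allV ((x ⊕ unit p))) (trans same Φx≡R))
        where
        Φ≟R = λ x → Φ θ x ≟ R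
        Φx≡R = proj₂ (∈-filter⁻ Φ≟R {xs = allV n} x∈)

    level-almost-invariant : (∀ x p → ∑ (upTo P) (λ θ → changed θ x p) ≤ T) → 0 < P → 0 < N →
      ∃[ θ ] ∃[ R ] 0 < length (level θ R)
        × M * (length (level θ R) * N) ≤ M * goodPairs (level θ R) B + length (level θ R) * N
    level-almost-invariant ∑-changed≤ 0<P 0<N with averaged ∑-changed≤ 0<P 0<N
    ... | θ , R , bad≤ , 0<AN = θ , R , *-pos-left 0<AN , (begin
      M * (length A * N)                ≡⟨ cong (M *_) (good+changed θ R) ⟨
      M * (goodPairs A B + bad)         ≡⟨ *-distribˡ-+ M (goodPairs A B) bad ⟩
      M * goodPairs A B + M * bad       ≤⟨ +-monoʳ-≤ (M * goodPairs A B) bad≤ ⟩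
      M * goodPairs A B + length A * N  ∎)
      where
      open ≤-Reasoning
      A = level θ R
      bad = ∑ A (λ x → ∑ cells (changed θ x))
      *-pos-left : ∀ {a b} → 0 < a * b → 0 < a
      *-pos-left {suc a} _ = s≤s z≤n

  module Residues (m M T : ℕ) .{{_ : NonZero M}} .{{_ : NonZero T}} where

    open Grid m

    private instance
      P≢0 : NonZero (M * T)
      P≢0 = m*n≢0 M T

    Φ : ℕ → V (m * m) → ℕ
    Φ = Potential.Φ (M * T) T

    -- An edge of the cube changes `Φ θ` by `h` of the row weight at its lower end, whichever end
    -- `x` is.
    lower-weight : V (m * m) → Fin m × Fin m → ℕ
    lower-weight x p@(i , j) = if bit x i j then wt (flip x p) i else wt x i

    Φ-invariant : ∀ θ x p → Potential.h (M * T) T θ (lower-weight x p) ≡ 0 → Φ θ (flip x p) ≡ Φ θ x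
    Φ-invariant θ x p@(i , j) h0 with bit x i j in xij
    ... | false = trans (Potential.Φ-flip-up (M * T) T θ x xij) (trans (cong (Φ θ x +_) h0) (+-identityʳ _))
    ... | true  = sym (trans (cong (Φ θ) (sym (flip-flip x p)))
                    (trans (Potential.Φ-flip-up (M * T) T θ (flip x p) (trans (bit-flip-same x i j) (cong not xij)))
                      (trans (cong (Φ θ (flip x p) +_) h0) (+-identityʳ _))))

    -- As `θ` runs through a period, `w + θ` meets every residue once, and `T` residues lie below
    -- `T`.
    residues : ∀ w → ∑ (upTo (M * T)) (λ θ → ι ((w + θ) % (M * T) <ᵇ T)) ≡ T
    residues w = begin
      ∑ (upTo P) (λ θ → ι ((w + θ) % P <ᵇ T))
        ≡⟨ ∑-periodic P (λ i → ι (i % P <ᵇ T)) (λ i → cong (λ r → ι (r <ᵇ T)) ([m+n]%n≡m%n i P)) w ⟩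
      ∑ (upTo P) (λ i → ι (i % P <ᵇ T))
        ≡⟨ ∑-upTo-cong P (λ i i<P → cong (λ r → ι (r <ᵇ T)) (m<n⇒m%n≡m i<P)) ⟩
      ∑ (upTo P) (λ i → ι (i <ᵇ T))
        ≡⟨ ∑-upTo-< (m≤n*m T M) ⟩
      T ∎
      where
      open ≡-Reasoning
      P = M * T

    open Averaging (cells m) unit Φ M T public hiding (P; N)

    ∑-changed≤ : ∀ x p → ∑ (upTo (M * T)) (λ θ → changed θ x p) ≤ T
    ∑-changed≤ x p = ≤-trans (∑-mono (upTo (M * T)) pointwise) (≤-reflexive (residues (lower-weight x p)))
      where
      pointwise : ∀ θ → changed θ x p ≤ ι ((lower-weight x p + θ) % (M * T) <ᵇ T)
      -- The move can change `Φ θ` only if `h` is nonzero at the lower end, that is, if the residue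
      -- lies below `T`.
      pointwise θ = ι-not≤ (Φ θ (flip x p) ≟ Φ θ x) λ lt →
        Φ-invariant θ x p (m≤n⇒m∸n≡0 {T} (≮⇒≥ λ r<T → subst Bool.T lt (<⇒<ᵇ {(lower-weight x p + θ) % (M * T)} r<T)))

-- Double counting of moves with weighted shares.

module DoubleCounting where

  open import Data.Bool using (Bool; true; false)
  open import Data.Nat
  open import Data.Nat.Properties
  open import Data.Nat.DivMod using (m/n*n≤m; m/n*n≡m)
  open import Data.Nat.Divisibility using (m∣m*n; ∣-trans; m≤n⇒m!∣n!)
  open import Data.List using (List; length)
  open import Data.List.Membership.Propositional using (_∈_)
  open import Relation.Binary.PropositionalEquality
  open import Defs using (V; _⊕_)
  open Sums
  open Cube

  module _ {n : ℕ} {I : Set} (cells : List I) (unit : I → V n) where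

    -- A common multiple of all the degrees below, so that weights L / d can be used instead of 1 / d.
    L : ℕ
    L = length cells !

    weight : ℕ → ℕ
    weight zero    = 0
    weight (suc d) = L / suc d

    *-weight≤ : ∀ d → d * weight d ≤ L
    *-weight≤ zero    = z≤n
    *-weight≤ (suc d) = ≤-trans (≤-reflexive (*-comm (suc d) (L / suc d))) (m/n*n≤m L (suc d))

    -- `suc d` divides its factorial, which divides `L` for degrees up to `length cells`, so the
    -- division in `weight` is exact.
    *-weight≡ : ∀ {d} → 0 < d → d ≤ length cells → d * weight d ≡ L
    *-weight≡ {suc d} _ d≤ = trans (*-comm (suc d) (L / suc d))
      (m/n*n≡m (∣-trans (m∣m*n {suc d} (d !)) (m≤n⇒m!∣n! d≤)))

    degree : (V n → I → Bool) → V n → ℕ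
    degree v x = ∑ cells (λ p → ι (v x p))

    degree≤ : ∀ v x → degree v x ≤ length cells
    degree≤ v x = ≤-trans (∑-mono cells (λ p → ι≤1 (v x p)))
      (≤-reflexive (trans (∑-const cells 1) (*-identityʳ _)))

    -- v x p says that the move from x to x ⊕ unit p is allowed, and v′ describes the reversed moves.
    -- Every vector hands out weight L in equal shares to the vectors moving into it, and
    -- share v v′ x is what x receives.
    share : (v v′ : V n → I → Bool) → V n → ℕ
    share v v′ x = ∑ cells (λ p → ι (v x p) * weight (degree v′ (x ⊕ unit p)))

    module _ (v v′ : V n → I → Bool) (reverse : ∀ x p → v′ (x ⊕ unit p) p ≡ v x p) where

      -- Regrouping the moves by their target `y` turns shares received into shares handed out: `y`
      -- contributes `Z y` times its degree times its `weight`, which is at most `L * Z y`. Uneven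
      -- degrees therefore do not weaken the bound.
      ∑-share≤ : ∀ (X Z : V n → ℕ) → (∀ x p → v x p ≡ true → X x ≤ Z (x ⊕ unit p)) →
                 ∑ (allV n) (λ x → X x * share v v′ x) ≤ L * ∑ (allV n) Z
      ∑-share≤ X Z X≤Z = begin
        ∑ (allV n) (λ x → X x * share v v′ x)
          ≡⟨ ∑-cong (allV n) (λ x → ∑-*ˡ cells (X x) (λ p → ι (v x p) * weight (degree v′ (x ⊕ unit p)))) ⟨
        ∑ (allV n) (λ x → ∑ cells (λ p → X x * (ι (v x p) * weight (degree v′ (x ⊕ unit p)))))
          ≤⟨ ∑-mono (allV n) (λ x → ∑-mono cells (λ p → transfer x p)) ⟩
        ∑ (allV n) (λ x → ∑ cells (λ p → F p (x ⊕ unit p)))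
          ≡⟨ ∑-swap (allV n) cells (λ x p → F p (x ⊕ unit p)) ⟩
        ∑ cells (λ p → ∑ (allV n) (λ x → F p (x ⊕ unit p)))
          ≡⟨ ∑-cong cells (λ p → ∑-translate (unit p) (F p)) ⟩
        ∑ cells (λ p → ∑ (allV n) (F p))
          ≡⟨ ∑-swap cells (allV n) F ⟩
        ∑ (allV n) (λ y → ∑ cells (λ p → F p y))
          ≤⟨ ∑-mono (allV n) given ⟩
        ∑ (allV n) (λ y → L * Z y)
          ≡⟨ ∑-*ˡ (allV n) L Z ⟩
        L * ∑ (allV n) Z ∎
        where
        open ≤-Reasoning
        F : I → V n → ℕ
        F p y = Z y * (ι (v′ y p) * weight (degree v′ y))
        transfer : ∀ x p → X x * (ι (v x p) * weight (degree v′ (x ⊕ unit p))) ≤ F p (x ⊕ unit p)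
        transfer x p with v x p in vxp
        ... | false = ≤-trans (≤-reflexive (*-zeroʳ (X x))) z≤n
        ... | true  rewrite reverse x p | vxp = *-monoˡ-≤ _ (X≤Z x p vxp)
        given : ∀ y → ∑ cells (λ p → F p y) ≤ L * Z y
        given y = begin
          ∑ cells (λ p → F p y)
            ≡⟨ ∑-*ˡ cells (Z y) (λ p → ι (v′ y p) * weight (degree v′ y)) ⟩
          Z y * ∑ cells (λ p → ι (v′ y p) * weight (degree v′ y))
            ≡⟨ cong (Z y *_) (∑-*ʳ cells (weight (degree v′ y)) (λ p → ι (v′ y p))) ⟩
          Z y * (degree v′ y * weight (degree v′ y))
            ≤⟨ *-monoʳ-≤ (Z y) (*-weight≤ (degree v′ y)) ⟩
          Z y * L
            ≡⟨ *-comm (Z y) L ⟩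
          L * Z y ∎

      -- Every target has `v′`-degree at most `degree v′ x + Q`, so each allowed move brings at
      -- least `L / (degree v′ x + Q)`. The denominator is multiplied out to stay in ℕ.
      degree≤share : ∀ Q x → (∀ p → v x p ≡ true → degree v′ (x ⊕ unit p) ≤ degree v′ x + Q) →
                     degree v x * L ≤ share v v′ x * (degree v′ x + Q)
      degree≤share Q x grow = begin
        degree v x * L
          ≡⟨ ∑-*ʳ cells L (λ p → ι (v x p)) ⟨
        ∑ cells (λ p → ι (v x p) * L)
          ≤⟨ ∑-mono∈ cells (λ {p} → pointwise p) ⟩
        ∑ cells (λ p → ι (v x p) * weight (degree v′ (x ⊕ unit p)) * (degree v′ x + Q))
          ≡⟨ ∑-*ʳ cells (degree v′ x + Q) (λ p → ι (v x p) * weight (degree v′ (x ⊕ unit p))) ⟩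
        share v v′ x * (degree v′ x + Q) ∎
        where
        open ≤-Reasoning
        pointwise : ∀ p → p ∈ cells →
          ι (v x p) * L ≤ ι (v x p) * weight (degree v′ (x ⊕ unit p)) * (degree v′ x + Q)
        pointwise p p∈ with v x p in vxp
        ... | false = z≤n
        ... | true  = begin
          1 * L                                   ≡⟨ *-identityˡ L ⟩
          L                                       ≡⟨ *-weight≡ positive (degree≤ v′ y) ⟨
          degree v′ y * weight (degree v′ y)      ≤⟨ *-monoˡ-≤ _ (grow p vxp) ⟩
          (degree v′ x + Q) * weight (degree v′ y) ≡⟨ *-comm _ (weight (degree v′ y)) ⟩
          weight (degree v′ y) * (degree v′ x + Q) ≡⟨ cong (_* (degree v′ x + Q)) (*-identityˡ (weight (degree v′ y))) ⟨
          1 * weight (degree v′ y) * (degree v′ x + Q) ∎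
          where
          y = x ⊕ unit p
          positive : 0 < degree v′ y
          -- The reversed move along `p` leaves `y`, so `weight` does not take its default value 0
          -- there.
          positive = ≤-trans (≤-reflexive (cong ι (sym (trans (reverse x p) vxp)))) (∈⇒≤∑ (λ p → ι (v′ y p)) p∈)

-- Propagating a lower bound along a chain of comparable numbers.

module Chain where

  open import Data.Nat
  open import Data.Nat.Properties
  open import Data.Sum using (inj₁; inj₂)
  open import Relation.Binary.PropositionalEquality

  -- A value β P Q d at one index forces a value at least P at all indices within distance d,
  -- when neighbouring values satisfy f k ≤ Q * suc (f (k ± 1)).
  β : (P Q : ℕ) → ℕ → ℕ
  β P Q zero    = P
  β P Q (suc d) = Q * suc (β P Q d)

  module _ (P Q : ℕ) .{{_ : NonZero Q}} where

    β-mono : ∀ {d e} → d ≤ e → β P Q d ≤ β P Q e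
    β-mono {d} {e} d≤e = go (≤⇒≤′ d≤e)
      where
      go : ∀ {e} → d ≤′ e → β P Q d ≤ β P Q e
      go ≤′-refl       = ≤-refl
      go (≤′-step d≤e) = ≤-trans (go d≤e) (≤-trans (n≤1+n _) (m≤n*m _ Q))

    β-step : ∀ {x y} d → x ≤ Q * suc y → β P Q (suc d) ≤ x → β P Q d ≤ y
    β-step d x≤ β≤x = s≤s⁻¹ (*-cancelˡ-≤ Q (≤-trans β≤x x≤))

    module _ (f : ℕ → ℕ) (up : ∀ {k} → k < P → f k ≤ Q * suc (f (suc k)))
                         (down : ∀ {k} → k < P → f (suc k) ≤ Q * suc (f k)) where

      climb : ∀ d k → d + k ≤ P → β P Q d ≤ f k → P ≤ f (d + k)
      climb zero    k le β≤ = β≤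
      climb (suc d) k le β≤ = subst (λ j → P ≤ f j) (+-suc d k)
        (climb d (suc k) (≤-trans (≤-reflexive (+-suc d k)) le)
          (β-step d (up (≤-trans (s≤s (m≤n+m k d)) le)) β≤))

      descend : ∀ d k → d + k ≤ P → β P Q d ≤ f (d + k) → P ≤ f k
      descend zero    k le β≤ = β≤
      descend (suc d) k le β≤ = descend d k (<⇒≤ le) (β-step d (down le) β≤)

      -- The distance from `k₀` to `k` is at most `P` and `β` is monotone in the distance, so
      -- `β P Q P` suffices in either direction.
      spread : ∀ {k₀ k} → k₀ ≤ P → k ≤ P → β P Q P ≤ f k₀ → P ≤ f k
      spread {k₀} {k} k₀≤P k≤P β≤ with ≤-total k₀ k
      ... | inj₁ k₀≤k = subst (λ j → P ≤ f j) (m∸n+n≡m k₀≤k)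
        (climb (k ∸ k₀) k₀ (≤-trans (≤-reflexive (m∸n+n≡m k₀≤k)) k≤P)
          (≤-trans (β-mono (≤-trans (m∸n≤m k k₀) k≤P)) β≤))
      ... | inj₂ k≤k₀ = descend (k₀ ∸ k) k (≤-trans (≤-reflexive (m∸n+n≡m k≤k₀)) k₀≤P)
        (subst (λ j → β P Q (k₀ ∸ k) ≤ f j) (sym (m∸n+n≡m k≤k₀))
          (≤-trans (β-mono (≤-trans (m∸n≤m k₀ k) k₀≤P)) β≤))

-- Moves along the marked cells, and their degrees.

module Moves where

  open import Data.Bool using (Bool; true; false; not; _∧_)
  open import Data.Fin using (Fin)
  import Data.Fin as Fin
  open import Data.Nat
  open import Data.Nat.Properties
  open import Data.List using (List; allFin)
  open import Data.List.Membership.Propositional.Properties using (∈-allFin)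
  open import Data.List.Relation.Unary.Unique.Propositional.Properties using (allFin⁺)
  open import Data.Product using (_×_; _,_; proj₁)
  open import Function using (_∘_; const)
  open import Relation.Binary.PropositionalEquality
  open import Relation.Nullary using (does; yes; no; contradiction)
  open import Defs using (V)
  open Sums
  open Cube
  open LevelSet using (cells; ι-yes; ι-no)
  open DoubleCounting

  -- W marks the cells of B′ that are used: exactly P of them in each of the rows marked by S.
  module Marked (m P : ℕ) (W : Fin m → Fin m → Bool) (S : Fin m → Bool)
                (size : ∀ i → ∑ (allFin m) (λ j → ι (W i j)) ≡ ι (S i) * P) where

    open Grid m

    ones zeros : V (m * m) → Fin m → ℕ
    ones x i = cnt (W i) x i
    zeros x i = ∑ (allFin m) (λ j → ι (W i j ∧ not (bit x i j)))

    -- A class c selects edges of the cube by the weight of the row in which they lie, and its number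
    -- of ones among the marked cells, both taken at the lower end of the edge.
    up down : (ℕ → ℕ → Bool) → V (m * m) → Fin m × Fin m → Bool
    up   c x (i , j) = (W i j ∧ not (bit x i j)) ∧ c (wt x i) (ones x i)
    down c x (i , j) = (W i j ∧ bit x i j) ∧ c (pred (wt x i)) (pred (ones x i))

    -- Both relations read the class at the lower end of the edge, so the two ends agree on it. This
    -- is the `reverse` hypothesis of the double counting.
    down-flip : ∀ c x p → down c (flip x p) p ≡ up c x p
    down-flip c x (i , j) with W i j in wij | bit x i j in xij
    ... | false | _     = refl
    ... | true  | true  rewrite bit-flip-same x i j | xij = refl
    ... | true  | false rewrite bit-flip-same x i j | xij | cnt-flip-up (W i) x {i} {j} wij xij
                              | cnt-flip-up (const true) x {i} {j} refl xij = refl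

    up-flip : ∀ c x p → up c (flip x p) p ≡ down c x p
    up-flip c x p = trans (sym (down-flip c (flip x p) p)) (cong (λ y → down c y p) (flip-flip x p))

    W-up : ∀ c x i j → up c x (i , j) ≡ true → W i j ≡ true × bit x i j ≡ false
    W-up c x i j eq with W i j | bit x i j
    ... | true | false = refl , refl

    ones+zeros : ∀ x i → ones x i + zeros x i ≡ ι (S i) * P
    ones+zeros x i = trans (sym (∑-+ (allFin m) (λ j → ι (W i j ∧ bit x i j)) (λ j → ι (W i j ∧ not (bit x i j)))))
      (trans (∑-cong (allFin m) (λ j → pointwise (W i j) (bit x i j))) (size i))
      where
      pointwise : ∀ a b → ι (a ∧ b) + ι (a ∧ not b) ≡ ι a
      pointwise false b     = refl
      pointwise true  false = refl
      pointwise true  true  = refl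

    row-up : ∀ c x i → ∑ (allFin m) (λ j → ι (up c x (i , j))) ≡ zeros x i * ι (c (wt x i) (ones x i))
    row-up c x i = trans (∑-cong (allFin m) (λ j → ι-∧ (W i j ∧ not (bit x i j)) (c (wt x i) (ones x i))))
      (∑-*ʳ (allFin m) (ι (c (wt x i) (ones x i))) (λ j → ι (W i j ∧ not (bit x i j))))

    row-down : ∀ c x i → ∑ (allFin m) (λ j → ι (down c x (i , j))) ≡ ones x i * ι (c (pred (wt x i)) (pred (ones x i)))
    row-down c x i = trans (∑-cong (allFin m) (λ j → ι-∧ (W i j ∧ bit x i j) (c (pred (wt x i)) (pred (ones x i)))))
      (∑-*ʳ (allFin m) (ι (c (pred (wt x i)) (pred (ones x i)))) (λ j → ι (W i j ∧ bit x i j)))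

    U D : (ℕ → ℕ → Bool) → V (m * m) → ℕ
    U c = degree (cells m) unit (up c)
    D c = degree (cells m) unit (down c)

    U-rows : ∀ c x → U c x ≡ ∑ (allFin m) (λ i → zeros x i * ι (c (wt x i) (ones x i)))
    U-rows c x = trans (∑-cartesianProductWith _,_ (allFin m) (allFin m) (λ p → ι (up c x p))) (∑-cong (allFin m) (row-up c x))

    D-rows : ∀ c x → D c x ≡ ∑ (allFin m) (λ i → ones x i * ι (c (pred (wt x i)) (pred (ones x i))))
    D-rows c x = trans (∑-cartesianProductWith _,_ (allFin m) (allFin m) (λ p → ι (down c x p))) (∑-cong (allFin m) (row-down c x))

    private
      *ι≤ : ∀ {a b} s c → a + b ≡ ι s * P → a * ι c ≤ P
      *ι≤ {a} s c eq = ≤-trans (*-mono-≤ {y = ι s * P} (≤-trans (m≤m+n a _) (≤-reflexive eq)) (ι≤1 c))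
        (≤-trans (≤-reflexive (*-identityʳ _)) (≤-trans (*-monoˡ-≤ P (ι≤1 s)) (≤-reflexive (*-identityˡ P))))

    -- Outside row `i` the summands agree, and row `i` adds at most `P`, whatever `g i` is.
    one-row : ∀ (f g : Fin m → ℕ) i → (∀ i′ → i′ ≢ i → f i′ ≡ g i′) → f i ≤ P →
              ∑ (allFin m) f ≤ ∑ (allFin m) g + P
    one-row f g i same f≤P = begin
      ∑ (allFin m) f                              ≤⟨ ∑-mono (allFin m) pointwise ⟩
      ∑ (allFin m) (λ i′ → g i′ + δ i′ * P)       ≡⟨ ∑-+ (allFin m) g (λ i′ → δ i′ * P) ⟩
      ∑ (allFin m) g + ∑ (allFin m) (λ i′ → δ i′ * P) ≡⟨ cong (∑ (allFin m) g +_) single ⟩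
      ∑ (allFin m) g + P                          ∎
      where
      open ≤-Reasoning
      δ : Fin m → ℕ
      δ i′ = ι (does (i′ Fin.≟ i))
      single : ∑ (allFin m) (λ i′ → δ i′ * P) ≡ P
      single = trans (∑-single (λ i′ → δ i′ * P) (allFin⁺ m) (∈-allFin i) (λ i′ ne → cong (_* P) (ι-no (i′ Fin.≟ i) ne)))
        (trans (cong (_* P) (ι-yes (i Fin.≟ i) refl)) (*-identityˡ P))
      pointwise : ∀ i′ → f i′ ≤ g i′ + δ i′ * P
      pointwise i′ with i′ Fin.≟ i
      ... | yes refl = ≤-trans f≤P (≤-trans (≤-reflexive (sym (*-identityˡ P))) (m≤n+m _ (g i)))
      ... | no  ne   = ≤-trans (≤-reflexive (same i′ ne)) (m≤m+n _ _)

    zeros-flip-other : ∀ x {i j i′} → i′ ≢ i → zeros (flip x (i , j)) i′ ≡ zeros x i′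
    zeros-flip-other x {i} {j} {i′} ne = ∑-cong (allFin m) λ j′ →
      cong (λ b → ι (W i′ j′ ∧ not b)) (bit-flip-other x (ne ∘ cong proj₁))

    -- A move alters a single row, and a row holds at most `P` marked cells. The bound on `U` below
    -- has the same reason.
    D-flip≤ : ∀ c x p → D c (flip x p) ≤ D c x + P
    D-flip≤ c x p@(i , j) = subst₂ (λ a b → a ≤ b + P) (sym (D-rows c (flip x p))) (sym (D-rows c x))
      (one-row _ _ i (λ i′ ne → cong₂ (λ a b → a * ι (c (pred b) (pred a)))
                         (cnt-flip-other (W i′) x {j = j} ne) (cnt-flip-other (const true) x {j = j} ne))
                     (*ι≤ {ones (flip x p) i} {zeros (flip x p) i} (S i) (c (pred (wt (flip x p) i)) (pred (ones (flip x p) i))) (ones+zeros (flip x p) i)))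

    U-flip≤ : ∀ c x p → U c (flip x p) ≤ U c x + P
    U-flip≤ c x p@(i , j) = subst₂ (λ a b → a ≤ b + P) (sym (U-rows c (flip x p))) (sym (U-rows c x))
      (one-row _ _ i (λ i′ ne → cong₂ _*_ (zeros-flip-other x {j = j} ne)
                         (cong₂ (λ a b → ι (c b a)) (cnt-flip-other (W i′) x {j = j} ne) (cnt-flip-other (const true) x {j = j} ne)))
                     (*ι≤ {zeros (flip x p) i} {ones (flip x p) i} (S i) (c (wt (flip x p) i) (ones (flip x p) i))
                       (trans (+-comm (zeros (flip x p) i) _) (ones+zeros (flip x p) i))))

    share-up share-down : (ℕ → ℕ → Bool) → V (m * m) → ℕ
    share-up   c = share (cells m) unit (up c) (down c)
    share-down c = share (cells m) unit (down c) (up c)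

    Λ : ℕ
    Λ = L (cells m) unit

    U≤share-up : ∀ c x → U c x * Λ ≤ share-up c x * (D c x + P)
    U≤share-up c x = degree≤share (cells m) unit (up c) (down c) (down-flip c) P x (λ p _ → D-flip≤ c x p)

    D≤share-down : ∀ c x → D c x * Λ ≤ share-down c x * (U c x + P)
    D≤share-down c x = degree≤share (cells m) unit (down c) (up c) (up-flip c) P x (λ p _ → U-flip≤ c x p)

    module _ (X Z : V (m * m) → ℕ) where

      ∑-share-up≤ : ∀ c → (∀ x p → up c x p ≡ true → X x ≤ Z (flip x p)) →
                    ∑ (allV (m * m)) (λ x → X x * share-up c x) ≤ Λ * ∑ (allV (m * m)) Z
      ∑-share-up≤ c = ∑-share≤ (cells m) unit (up c) (down c) (down-flip c) X Z

      ∑-share-down≤ : ∀ c → (∀ x p → down c x p ≡ true → X x ≤ Z (flip x p)) →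
                      ∑ (allV (m * m)) (λ x → X x * share-down c x) ≤ Λ * ∑ (allV (m * m)) Z
      ∑-share-down≤ c = ∑-share≤ (cells m) unit (down c) (up c) (up-flip c) X Z

-- Row states, and the dichotomy between state shares and crossing shares.

module Expansion where

  open import Data.Bool as Bool using (Bool; true; false; _∧_)
  open import Data.Bool.Properties using (∧-zeroʳ)
  open import Data.Fin using (Fin)
  open import Data.Nat
  open import Data.Nat.Properties
  open import Data.Nat.DivMod using (m%n<n; m<n⇒m%n≡m; [m+n]%n≡m%n; %-distribˡ-+; m%n%n≡m%n)
  open import Data.List using (List; allFin; upTo; cartesianProduct; length)
  open import Data.List.Properties using (length-upTo)
  open import Data.List.Membership.Propositional.Properties using (∈-cartesianProduct⁺; ∈-cartesianProduct⁻; ∈-upTo⁺; ∈-upTo⁻)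
  open import Data.Product using (∃-syntax; _×_; _,_; proj₁; proj₂)
  open import Data.Sum using (_⊎_; inj₁; inj₂)
  open import Relation.Binary.PropositionalEquality
  open import Relation.Nullary using (does; yes; no; contradiction)
  open import Defs using (V)
  open Sums
  open Cube
  open Chain
  open LevelSet using (ι-yes; ι-no)

  ≡ᵇ-yes : ∀ {a b} → a ≡ b → (a ≡ᵇ b) ≡ true
  ≡ᵇ-yes {zero}  refl = refl
  ≡ᵇ-yes {suc a} refl = ≡ᵇ-yes {a} refl

  ≡ᵇ-true : ∀ {a b} → (a ≡ᵇ b) ≡ true → a ≡ b
  ≡ᵇ-true {a} {b} eq = ≡ᵇ⇒≡ a b (subst Bool.T (sym eq) _)

  ∧-true : ∀ {a b} → a ∧ b ≡ true → a ≡ true × b ≡ true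
  ∧-true {true} {true} _ = refl , refl

  complement-residue : ∀ P .{{_ : NonZero P}} {a t} → a < P → t < P → ∃[ k ] k < P × (a + k) % P ≡ t
  -- The witness is `t - a` modulo `P`, with `P ∸ a` in place of `- a`.
  complement-residue P {a} {t} a<P t<P = (t + (P ∸ a)) % P , m%n<n (t + (P ∸ a)) P , (begin
    (a + (t + (P ∸ a)) % P) % P          ≡⟨ %-distribˡ-+ a ((t + (P ∸ a)) % P) P ⟩
    (a % P + (t + (P ∸ a)) % P % P) % P  ≡⟨ cong (λ r → (a % P + r) % P) (m%n%n≡m%n (t + (P ∸ a)) P) ⟩
    (a % P + (t + (P ∸ a)) % P) % P      ≡⟨ %-distribˡ-+ a (t + (P ∸ a)) P ⟨
    (a + (t + (P ∸ a))) % P              ≡⟨ cong (_% P) rearrange ⟩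
    (t + P) % P                          ≡⟨ [m+n]%n≡m%n t P ⟩
    t % P                                ≡⟨ m<n⇒m%n≡m t<P ⟩
    t                                    ∎)
    where
    open ≡-Reasoning
    rearrange : a + (t + (P ∸ a)) ≡ t + P
    rearrange = begin
      a + (t + (P ∸ a)) ≡⟨ +-comm a _ ⟩
      t + (P ∸ a) + a   ≡⟨ +-assoc t _ _ ⟩
      t + (P ∸ a + a)   ≡⟨ cong (t +_) (m∸n+n≡m (<⇒≤ a<P)) ⟩
      t + P             ∎

  half-share : ∀ {P L U D u} → 0 < P → P ≤ U → D ≤ U → U * L ≤ u * (D + P) → L ≤ 2 * u
  half-share {P} {L} {U} {D} {u} 0<P P≤U D≤U U≤ = *-cancelˡ-≤ U {{>-nonZero (<-≤-trans 0<P P≤U)}} (begin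
    U * L         ≤⟨ U≤ ⟩
    u * (D + P)   ≤⟨ *-monoʳ-≤ u (+-mono-≤ D≤U P≤U) ⟩
    u * (U + U)   ≡⟨ *-distribˡ-+ u U U ⟩
    u * U + u * U ≡⟨ cong (u * U +_) (+-identityʳ (u * U)) ⟨
    2 * (u * U)   ≡⟨ *-assoc 2 u U ⟨
    2 * u * U     ≡⟨ *-comm (2 * u) U ⟩
    U * (2 * u)   ∎)
    where open ≤-Reasoning

  -- The larger of the two degrees dominates both the other one and `P`, so its direction receives a
  -- share of at least `L / 2`.
  half-share-either : ∀ {P L U D u d} → 0 < P → P ≤ U → U * L ≤ u * (D + P) → D * L ≤ d * (U + P) → L ≤ 2 * (u + d)
  half-share-either {P} {L} {U} {D} {u} {d} 0<P P≤U U≤ D≤ with ≤-total D U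
  ... | inj₁ D≤U = ≤-trans (half-share {P} {L} {U} {D} {u} 0<P P≤U D≤U U≤) (*-monoʳ-≤ 2 (m≤m+n u d))
  ... | inj₂ U≤D = ≤-trans (half-share {P} {L} {D} {U} {d} 0<P (≤-trans P≤U U≤D) U≤D D≤) (*-monoʳ-≤ 2 (m≤n+m d u))

  module _ (P θ : ℕ) .{{_ : NonZero P}} where

    -- w ∸ o counts the ones outside the marked cells, so no marked move changes a.
    state : ℕ → ℕ → ℕ → ℕ → Bool
    state a k w o = does ((w ∸ o + θ) % P ≟ a) ∧ (o ≡ᵇ k)

    state-ones : ∀ {a k w o} → state a k w o ≡ true → o ≡ k
    state-ones {a} {k} {w} {o} eq = ≡ᵇ-true (proj₂ (∧-true {does ((w ∸ o + θ) % P ≟ a)} eq))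

    -- Split `w` into the ones outside and inside the marked cells; `o ≤ w` makes the truncated
    -- difference exact.
    state-residue : ∀ {a k w o} → o ≤ w → state a k w o ≡ true → (w + θ) % P ≡ (a + k) % P
    state-residue {a} {k} {w} {o} o≤w eq = begin
      (w + θ) % P               ≡⟨ cong (λ v → (v + θ) % P) (m∸n+n≡m o≤w) ⟨
      (w ∸ o + o + θ) % P       ≡⟨ cong (_% P) (trans (+-assoc (w ∸ o) o θ) (trans (cong (w ∸ o +_) (+-comm o θ)) (sym (+-assoc (w ∸ o) θ o)))) ⟩
      (w ∸ o + θ + o) % P       ≡⟨ %-distribˡ-+ (w ∸ o + θ) o P ⟩
      ((w ∸ o + θ) % P + o % P) % P ≡⟨ cong (λ r → (r + o % P) % P) (trans (sym (m%n%n≡m%n (w ∸ o + θ) P)) (cong (_% P) r≡a)) ⟩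
      (a % P + o % P) % P       ≡⟨ %-distribˡ-+ a o P ⟨
      (a + o) % P               ≡⟨ cong (λ o → (a + o) % P) (state-ones {a} {k} {w} {o} eq) ⟩
      (a + k) % P               ∎
      where
      open ≡-Reasoning
      r≡a : (w ∸ o + θ) % P ≡ a
      r≡a = ≡ᵇ-true (proj₁ (∧-true {does ((w ∸ o + θ) % P ≟ a)} eq))

    -- Removing a marked one lowers `w` and `o` together: `a` stays and `k` drops by one.
    state-suc : ∀ a k w o → state a (suc k) w (suc o) ≡ state a k (pred w) o
    state-suc a k w o = cong (λ v → does ((v + θ) % P ≟ a) ∧ (o ≡ᵇ k)) (∸-suc-pred w o)
      where
      ∸-suc-pred : ∀ w o → w ∸ suc o ≡ pred w ∸ o
      ∸-suc-pred zero    o = sym (0∸n≡0 o)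
      ∸-suc-pred (suc w) o = refl

    -- With `k < P`, a selected row in this state has only `k` ones among its `P` marked cells, so
    -- some marked cell is zero.
    state-≤-zeros : ∀ s a {k} w o z → k < P → o + z ≡ ι s * P →
                    ι s * ι (state a k w o) ≤ z * ι (state a k w o)
    state-≤-zeros false a     w o z k<P eq = z≤n
    state-≤-zeros true  a {k} w o z k<P eq with state a k w o in st
    ... | false = z≤n
    ... | true  = *-monoˡ-≤ 1 (+-cancelˡ-≤ o 1 z (≤-trans (≤-reflexive (+-comm o 1))
                    (≤-trans (s≤s (≤-reflexive (state-ones {a} {k} {w} {o} st))) (≤-trans k<P (≤-reflexive (sym (trans eq (*-identityˡ P))))))))

    zeros-≤-state : ∀ s b o z → o + z ≡ ι s * P → z * ι b ≤ P * (ι s * ι b)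
    zeros-≤-state s b o z eq = ≤-trans (*-monoˡ-≤ (ι b) (≤-trans (m≤n+m z o) (≤-reflexive (trans eq (*-comm (ι s) P)))))
      (≤-reflexive (*-assoc P (ι s) (ι b)))

    state-≤-ones : ∀ s a k w o → ι s * ι (state a (suc k) w o) ≤ o * ι (state a k (pred w) (pred o))
    -- Here `pred 0` is a default value: a row without marked ones is never in a state with `suc k`,
    -- so the left side vanishes.
    state-≤-ones s a k w zero    rewrite ∧-zeroʳ (does ((w + θ) % P ≟ a)) = ≤-reflexive (*-zeroʳ (ι s))
    state-≤-ones s a k w (suc o) rewrite state-suc a k w o = *-monoˡ-≤ _ (≤-trans (ι≤1 s) (s≤s (z≤n {o})))

    ones-≤-state : ∀ s a k w o z → o + z ≡ ι s * P →
                   o * ι (state a k (pred w) (pred o)) ≤ P * (ι s * ι (state a (suc k) w o))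
    ones-≤-state s a k w zero    z eq = z≤n
    ones-≤-state s a k w (suc o) z eq rewrite state-suc a k w o =
      zeros-≤-state s (state a k (pred w) o) z (suc o) (trans (+-comm z (suc o)) eq)

    -- The test is `h w = s` for the increment `h` of the potential: an upward move in this class
    -- raises `Φ` by `s`, a downward one lowers it by `s`.
    crossing : ℕ → ℕ → ℕ → ℕ → Bool
    crossing T s w o = (T ∸ (w + θ) % P) ≡ᵇ s

    state⇒crossing : ∀ {T s a k w o} → s ≤ T → (a + k) % P ≡ T ∸ s → o ≤ w → state a k w o ≡ true →
                     crossing T s w o ≡ true
    state⇒crossing {T} {s} {a} {k} {w} {o} s≤T eq o≤w st = ≡ᵇ-yes
      (trans (cong (T ∸_) (trans (state-residue {a} {k} {w} {o} o≤w st) eq)) (m∸[m∸n]≡n s≤T))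

  module Shares (m P T θ ρ : ℕ) .{{_ : NonZero P}} .{{_ : NonZero ρ}}
                (W : Fin m → Fin m → Bool) (S : Fin m → Bool)
                (size : ∀ i → ∑ (allFin m) (λ j → ι (W i j)) ≡ ι (S i) * P) where

    open Grid m
    open Moves.Marked m P W S size

    private
      c : ℕ → ℕ → ℕ → ℕ → Bool
      c = state P θ

      x-state : ℕ → ℕ → V (m * m) → Fin m → ℕ
      x-state a k x i = ι (c a k (wt x i) (ones x i))

    number : V (m * m) → ℕ → ℕ → ℕ
    number x a k = ∑ (allFin m) (λ i → ι (S i) * x-state a k x i)

    -- Each selected row in state `(a, k)` with `k < P` offers between 1 and `P` upward moves, so
    -- counting rows and counting moves agree up to a factor `P`.
    number≤U : ∀ x a {k} → k < P → number x a k ≤ U (c a k) x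
    number≤U x a {k} k<P = ≤-trans
      (∑-mono (allFin m) (λ i → state-≤-zeros P θ (S i) a (wt x i) (ones x i) (zeros x i) k<P (ones+zeros x i)))
      (≤-reflexive (sym (U-rows (c a k) x)))

    U≤number : ∀ x a k → U (c a k) x ≤ P * number x a k
    U≤number x a k = ≤-trans (≤-reflexive (U-rows (c a k) x)) (≤-trans
      (∑-mono (allFin m) (λ i → zeros-≤-state P θ (S i) (c a k (wt x i) (ones x i)) (ones x i) (zeros x i) (ones+zeros x i)))
      (≤-reflexive (∑-*ˡ (allFin m) P (λ i → ι (S i) * x-state a k x i))))

    -- Classes are read at the lower end, so the downward moves of class `(a, k)` start in rows of
    -- state `(a, suc k)`.
    number≤D : ∀ x a k → number x a (suc k) ≤ D (c a k) x
    number≤D x a k = ≤-trans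
      (∑-mono (allFin m) (λ i → state-≤-ones P θ (S i) a k (wt x i) (ones x i)))
      (≤-reflexive (sym (D-rows (c a k) x)))

    D≤number : ∀ x a k → D (c a k) x ≤ P * number x a (suc k)
    D≤number x a k = ≤-trans (≤-reflexive (D-rows (c a k) x)) (≤-trans
      (∑-mono (allFin m) (λ i → ones-≤-state P θ (S i) a k (wt x i) (ones x i) (zeros x i) (ones+zeros x i)))
      (≤-reflexive (∑-*ˡ (allFin m) P (λ i → ι (S i) * x-state a (suc k) x i))))

    ones≤wt : ∀ x i → ones x i ≤ wt x i
    ones≤wt x i = ∑-mono (allFin m) (λ j → pointwise (W i j) (bit x i j))
      where
      pointwise : ∀ a b → ι (a ∧ b) ≤ ι b
      pointwise false b = z≤n
      pointwise true  b = ≤-refl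

    -- A row in state `(a, k)` has weight residue `(a + k) % P = T ∸ s`, hence increment `s`, and
    -- each of its marked zeros gives a move of this crossing.
    number≤U-crossing : ∀ x {a k s} → k < P → s ≤ T → (a + k) % P ≡ T ∸ s → number x a k ≤ U (crossing P θ T s) x
    number≤U-crossing x {a} {k} {s} k<P s≤T eq = ≤-trans (∑-mono (allFin m) pointwise)
      (≤-reflexive (sym (U-rows (crossing P θ T s) x)))
      where
      pointwise : ∀ i → ι (S i) * x-state a k x i ≤ zeros x i * ι (crossing P θ T s (wt x i) (ones x i))
      pointwise i = ≤-trans (state-≤-zeros P θ (S i) a (wt x i) (ones x i) (zeros x i) k<P (ones+zeros x i))
        (*-monoʳ-≤ (zeros x i) (implies (c a k (wt x i) (ones x i)) _
          (state⇒crossing P θ {T} {s} {a} {k} {wt x i} {ones x i} s≤T eq (ones≤wt x i))))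
        where
        implies : ∀ b b′ → (b ≡ true → b′ ≡ true) → ι b ≤ ι b′
        implies false b′ f = z≤n
        implies true  b′ f = ≤-reflexive (cong ι (sym (f refl)))

    -- If no state receives a large share, then number x a k and number x a (suc k) differ by a bounded factor,
    -- so for the a found by the pigeonhole principle they are all at least P, and each crossing has many edges at x.
    number-ratio : ∀ {L u n n′ U D} → 0 < L → u ≤ ρ * L → n ≤ U → U * L ≤ u * (D + P) → D ≤ P * n′ →
                   n ≤ ρ * P * suc n′
    number-ratio {L} {u} {n} {n′} {U} {D} 0<L u≤ n≤U UL≤ D≤ = ≤-trans n≤U (*-cancelʳ-≤ U _ L {{>-nonZero 0<L}} (begin
      U * L                 ≤⟨ UL≤ ⟩
      u * (D + P)           ≤⟨ *-mono-≤ u≤ (+-monoˡ-≤ P D≤) ⟩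
      ρ * L * (P * n′ + P)  ≡⟨ cong (ρ * L *_) (trans (+-comm (P * n′) P) (sym (*-suc P n′))) ⟩
      ρ * L * (P * suc n′)  ≡⟨ interchange ρ L P (suc n′) ⟩
      ρ * P * (L * suc n′)  ≡⟨ cong (ρ * P *_) (*-comm L (suc n′)) ⟩
      ρ * P * (suc n′ * L)  ≡⟨ *-assoc (ρ * P) (suc n′) L ⟨
      ρ * P * suc n′ * L    ∎))
      where
      open ≤-Reasoning
      open import Algebra.Properties.CommutativeSemigroup *-commutativeSemigroup using (interchange)

    0<Λ : 0 < Λ
    0<Λ = n!>0 (length (LevelSet.cells m))
      where
      n!>0 : ∀ n → 0 < n !
      n!>0 zero    = s≤s z≤n
      n!>0 (suc n) = *-mono-≤ {1} {suc n} {1} (s≤s z≤n) (n!>0 n)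

    both : (ℕ → ℕ → Bool) → V (m * m) → ℕ
    both κ x = share-up κ x + share-down κ x

    -- Here `k < P`, because a class is read at the lower end of an edge, where some marked cell is
    -- still zero.
    states : List (ℕ × ℕ)
    states = cartesianProduct (upTo P) (upTo P)

    state-share crossing-share : V (m * m) → ℕ
    state-share x = ∑ states (λ (a , k) → both (c a k) x)
    -- The shift lets the increments run over `1, …, T`; increment 0 would stay on the level set.
    crossing-share x = ∑ (upTo T) (λ s → both (crossing P θ T (suc s)) x)

    -- Every selected row is in one of `P * suc P` states, since `k = P` is now possible too.
    pigeonhole : P * suc P * β P (ρ * P) P ≤ ∑ (allFin m) (λ i → ι (S i)) → ∀ x →
                 ∃[ a ] ∃[ k ] a < P × k ≤ P × β P (ρ * P) P ≤ number x a k
    pigeonhole many x with average ak (λ _ → β₀) (λ (a , k) → number x a k) β≤ (<-≤-trans 0<∑β β≤)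
      where
      ak : List (ℕ × ℕ)
      ak = cartesianProduct (upTo P) (upTo (suc P))
      β₀ : ℕ
      β₀ = β P (ρ * P) P
      ∑β≡ : ∑ ak (λ _ → β₀) ≡ P * suc P * β₀
      ∑β≡ = begin
        ∑ ak (λ _ → β₀)                                    ≡⟨ ∑-cartesianProductWith _,_ (upTo P) (upTo (suc P)) (λ _ → β₀) ⟩
        ∑ (upTo P) (λ _ → ∑ (upTo (suc P)) (λ _ → β₀))     ≡⟨ ∑-const (upTo P) _ ⟩
        length (upTo P) * ∑ (upTo (suc P)) (λ _ → β₀)      ≡⟨ cong₂ _*_ (length-upTo P) (trans (∑-const (upTo (suc P)) β₀) (cong (_* β₀) (length-upTo (suc P)))) ⟩
        P * (suc P * β₀)                                   ≡⟨ *-assoc P (suc P) β₀ ⟨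
        P * suc P * β₀                                     ∎
        where open ≡-Reasoning
      in-some-state : ∀ i → ι (S i) ≤ ∑ ak (λ (a , k) → ι (S i) * x-state a k x i)
      in-some-state i with S i | ones+zeros x i
      ... | false | _  = z≤n
      ... | true  | eq = ≤-trans (≤-reflexive (sym here≡1))
          (∈⇒≤∑ (λ (a , k) → 1 * x-state a k x i) (∈-cartesianProduct⁺ (∈-upTo⁺ a<P) (∈-upTo⁺ (s≤s k≤P))))
        where
        a = (wt x i ∸ ones x i + θ) % P
        k = ones x i
        a<P : a < P
        a<P = m%n<n (wt x i ∸ ones x i + θ) P
        k≤P : k ≤ P
        k≤P = ≤-trans (m≤m+n k (zeros x i)) (≤-reflexive (trans eq (*-identityˡ P)))
        here≡1 : 1 * x-state a k x i ≡ 1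
        here≡1 = trans (*-identityˡ _) (trans (ι-∧ (does (a ≟ a)) (k ≡ᵇ k))
          (cong₂ _*_ (ι-yes (a ≟ a) refl) (cong ι (≡ᵇ-yes {k} refl))))
      β≤ : ∑ ak (λ _ → β₀) ≤ ∑ ak (λ (a , k) → number x a k)
      β≤ = begin
        ∑ ak (λ _ → β₀)                                                      ≡⟨ ∑β≡ ⟩
        P * suc P * β₀                                                       ≤⟨ many ⟩
        ∑ (allFin m) (λ i → ι (S i))                                         ≤⟨ ∑-mono (allFin m) in-some-state ⟩
        ∑ (allFin m) (λ i → ∑ ak (λ (a , k) → ι (S i) * x-state a k x i))    ≡⟨ ∑-swap (allFin m) ak (λ i (a , k) → ι (S i) * x-state a k x i) ⟩
        ∑ ak (λ (a , k) → number x a k)                                      ∎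
        where open ≤-Reasoning
      0<∑β : 0 < ∑ ak (λ _ → β₀)
      0<∑β = subst (0 <_) (sym ∑β≡) (*-mono-≤ {1} {P * suc P} {1} (*-mono-≤ {1} {P} {1} (>-nonZero⁻¹ P) (s≤s z≤n))
        (≤-trans (>-nonZero⁻¹ P) (β-mono P (ρ * P) {{m*n≢0 ρ P}} {0} {P} z≤n)))
    ... | (a , k) , ak∈ , β≤n , _ with ∈-cartesianProduct⁻ (upTo P) (upTo (suc P)) ak∈
    ...   | a∈ , k∈ = a , k , ∈-upTo⁻ a∈ , s≤s⁻¹ (∈-upTo⁻ k∈) , β≤n

    large-share : T ≤ P → P * suc P * β P (ρ * P) P ≤ ∑ (allFin m) (λ i → ι (S i)) → ∀ x →
                  ρ * Λ ≤ state-share x ⊎ T * Λ ≤ 2 * crossing-share x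
    large-share T≤P many x with ρ * Λ ≤? state-share x | pigeonhole many x
    ... | yes large | _ = inj₁ large
    ... | no  small | a , k₀ , a<P , k₀≤P , β≤n = inj₂ (begin
      T * Λ                                  ≡⟨ cong (_* Λ) (length-upTo T) ⟨
      length (upTo T) * Λ                    ≡⟨ ∑-const (upTo T) Λ ⟨
      ∑ (upTo T) (λ _ → Λ)                   ≤⟨ ∑-mono∈ (upTo T) (λ s∈ → each (∈-upTo⁻ s∈)) ⟩
      ∑ (upTo T) (λ s → 2 * both (crossing P θ T (suc s)) x) ≡⟨ ∑-*ˡ (upTo T) 2 (λ s → both (crossing P θ T (suc s)) x) ⟩
      2 * crossing-share x                   ∎)
      where
      open ≤-Reasoning
      both≤ : ∀ {k} → k < P → both (c a k) x ≤ ρ * Λ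
      both≤ k<P = ≤-trans (∈⇒≤∑ (λ (a , k) → both (c a k) x) (∈-cartesianProduct⁺ (∈-upTo⁺ a<P) (∈-upTo⁺ k<P)))
                          (<⇒≤ (≰⇒> small))
      climb-ratio : ∀ {k} → k < P → number x a k ≤ ρ * P * suc (number x a (suc k))
      climb-ratio {k} k<P = number-ratio {Λ} {share-up (c a k) x} {_} {_} {U (c a k) x} {D (c a k) x}
        0<Λ (≤-trans (m≤m+n _ (share-down (c a k) x)) (both≤ k<P)) (number≤U x a k<P) (U≤share-up (c a k) x) (D≤number x a k)
      descend-ratio : ∀ {k} → k < P → number x a (suc k) ≤ ρ * P * suc (number x a k)
      descend-ratio {k} k<P = number-ratio {Λ} {share-down (c a k) x} {_} {_} {D (c a k) x} {U (c a k) x}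
        0<Λ (≤-trans (m≤n+m _ (share-up (c a k) x)) (both≤ k<P)) (number≤D x a k) (D≤share-down (c a k) x) (U≤number x a k)
      P≤number : ∀ {k} → k ≤ P → P ≤ number x a k
      -- The threshold in `pigeonhole` is the chain value at distance `P` for the ratio `ρ * P`, so
      -- the bound `P` reaches every `k`.
      P≤number k≤P = spread P (ρ * P) {{m*n≢0 ρ P}} (number x a) climb-ratio descend-ratio k₀≤P k≤P β≤n
      each : ∀ {s} → s < T → Λ ≤ 2 * both (crossing P θ T (suc s)) x
      -- Whatever `a` is, some `k < P` puts the rows of state `(a, k)` on the residue with increment
      -- `suc s`. This is why all `k` must be well populated.
      each {s} s<T with complement-residue P {a} {T ∸ suc s} a<P (<-≤-trans (∸-monoʳ-< {T} (s≤s z≤n) s<T) T≤P)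
      ... | k , k<P , eq = half-share-either {P} {Λ} {U κ x} {D κ x} {share-up κ x} {share-down κ x} (>-nonZero⁻¹ P)
          (≤-trans (P≤number (<⇒≤ k<P)) (number≤U-crossing x {a} {k} {suc s} k<P s<T eq))
          (U≤share-up κ x) (D≤share-down κ x)
        where
        κ = crossing P θ T (suc s)

-- Vertex expansion of subsets of a level set.

module Boundary where

  open import Data.Bool as Bool using (Bool; true; false; not; _∧_)
  open import Data.Fin using (Fin)
  open import Data.Nat
  open import Data.Nat.Properties
  open import Data.List using (List; allFin; upTo; length)
  open import Data.List.Properties using (length-upTo)
  open import Data.List.Relation.Unary.Unique.Propositional.Properties using (upTo⁺)
  open import Data.Product using (_,_; proj₁; proj₂)
  open import Data.Sum using (inj₁; inj₂)
  open import Relation.Binary.PropositionalEquality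
  open import Relation.Nullary using (yes; no; contradiction)
  open import Defs using (V)
  open Sums
  open Cube
  open Chain using (β)
  open Expansion using (∧-true; ≡ᵇ-true; ≡ᵇ-yes; crossing; module Shares)

  -- The values R ± s with 1 ≤ s ≤ T are distinct.
  shifted-level : ∀ T φ R → ∑ (upTo T) (λ s → ι (φ ≡ᵇ R + suc s) + ι (φ + suc s ≡ᵇ R)) ≤ 1
  shifted-level T φ R = ≤-trans (≤-reflexive (∑-+ (upTo T) (λ s → ι (φ ≡ᵇ R + suc s)) (λ s → ι (φ + suc s ≡ᵇ R)))) sum≤1
    where
    up≤1 : ∑ (upTo T) (λ s → ι (φ ≡ᵇ R + suc s)) ≤ 1
    up≤1 = ∑-atMostOne (λ s → φ ≡ᵇ R + suc s) (upTo⁺ T) λ s t p q →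
      suc-injective (+-cancelˡ-≡ R _ _ (trans (sym (≡ᵇ-true {φ} p)) (≡ᵇ-true {φ} q)))
    down≤1 : ∑ (upTo T) (λ s → ι (φ + suc s ≡ᵇ R)) ≤ 1
    down≤1 = ∑-atMostOne (λ s → φ + suc s ≡ᵇ R) (upTo⁺ T) λ s t p q →
      suc-injective (+-cancelˡ-≡ φ _ _ (trans (≡ᵇ-true {φ + suc s} p) (sym (≡ᵇ-true {φ + suc t} q))))
    vanish : ∀ (p : ℕ → Bool) → (∀ s → p s ≢ true) → ∑ (upTo T) (λ s → ι (p s)) ≡ 0
    vanish p never = trans (∑-cong (upTo T) (λ s → zero′ (p s) (never s))) (∑-zero (upTo T))
      where
      zero′ : ∀ b → b ≢ true → ι b ≡ 0
      zero′ false _  = refl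
      zero′ true  ne = contradiction refl ne
    sum≤1 : ∑ (upTo T) (λ s → ι (φ ≡ᵇ R + suc s)) + ∑ (upTo T) (λ s → ι (φ + suc s ≡ᵇ R)) ≤ 1
    sum≤1 with ≤-total φ R
    ... | inj₁ φ≤R = ≤-trans (≤-reflexive (cong (_+ ∑ (upTo T) (λ s → ι (φ + suc s ≡ᵇ R)))
        (vanish (λ s → φ ≡ᵇ R + suc s) λ s p → <⇒≢ (≤-<-trans φ≤R (m<m+n R (s≤s z≤n))) (≡ᵇ-true {φ} p)))) down≤1
    ... | inj₂ R≤φ = ≤-trans (≤-reflexive (trans (cong (∑ (upTo T) (λ s → ι (φ ≡ᵇ R + suc s)) +_)
        (vanish (λ s → φ + suc s ≡ᵇ R) λ s p → <⇒≢ (≤-<-trans R≤φ (m<m+n φ (s≤s z≤n))) (sym (≡ᵇ-true {φ + suc s} p)))) (+-identityʳ _))) up≤1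

  module _ (m P T θ R : ℕ) .{{_ : NonZero P}} .{{_ : NonZero T}} (T≤P : T ≤ P)
           (W : Fin m → Fin m → Bool) (S : Fin m → Bool)
           (size : ∀ i → ∑ (allFin m) (λ j → ι (W i j)) ≡ ι (S i) * P)
           (many : P * suc P * β P (P * P * T * P) P ≤ ∑ (allFin m) (λ i → ι (S i)))
           where

    open Grid m
    open Potential P T θ
    open Moves.Marked m P W S size

    private
      -- The factor `P * P` pays for summing over all state classes, so that a large state share
      -- also yields expansion by a multiple of `T`.
      ρ = P * P * T
      instance
        PP≢0 : NonZero (P * P)
        PP≢0 = m*n≢0 P P
        ρ≢0 : NonZero (P * P * T)
        ρ≢0 = m*n≢0 (P * P) T

    open Shares m P T θ (P * P * T) W S size

    module _ (X Y : V (m * m) → ℕ) (on-level : ∀ x → 0 < X x → Φ x ≡ R)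
             (reach : ∀ x i j → W i j ≡ true → X x ≤ Y (flip x (i , j))) where

      ΣX ΣY : ℕ
      ΣX = ∑ (allV (m * m)) X
      ΣY = ∑ (allV (m * m)) Y

      reach-up : ∀ c x p → up c x p ≡ true → X x ≤ Y (flip x p)
      reach-up c x (i , j) eq = reach x i j (proj₁ (W-up c x i j eq))

      reach-down : ∀ c x p → down c x p ≡ true → X x ≤ Y (flip x p)
      reach-down c x p@(i , j) eq = reach x i j (proj₁ (W-up c (flip x p) i j (trans (up-flip c x p) eq)))

      ∑-both : ∀ c (Z Z′ : V (m * m) → ℕ) → (∀ x p → up c x p ≡ true → X x ≤ Z (flip x p)) →
               (∀ x p → down c x p ≡ true → X x ≤ Z′ (flip x p)) →
               ∑ (allV (m * m)) (λ x → X x * both c x) ≤ Λ * ∑ (allV (m * m)) (λ y → Z y + Z′ y)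
      ∑-both c Z Z′ up≤ down≤ = begin
        ∑ (allV (m * m)) (λ x → X x * both c x)
          ≡⟨ ∑-cong (allV (m * m)) (λ x → *-distribˡ-+ (X x) (share-up c x) (share-down c x)) ⟩
        ∑ (allV (m * m)) (λ x → X x * share-up c x + X x * share-down c x)
          ≡⟨ ∑-+ (allV (m * m)) (λ x → X x * share-up c x) (λ x → X x * share-down c x) ⟩
        ∑ (allV (m * m)) (λ x → X x * share-up c x) + ∑ (allV (m * m)) (λ x → X x * share-down c x)
          ≤⟨ +-mono-≤ (∑-share-up≤ X Z c up≤) (∑-share-down≤ X Z′ c down≤) ⟩
        Λ * ∑ (allV (m * m)) Z + Λ * ∑ (allV (m * m)) Z′
          ≡⟨ *-distribˡ-+ Λ (∑ (allV (m * m)) Z) (∑ (allV (m * m)) Z′) ⟨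
        Λ * (∑ (allV (m * m)) Z + ∑ (allV (m * m)) Z′)
          ≡⟨ cong (Λ *_) (∑-+ (allV (m * m)) Z Z′) ⟨
        Λ * ∑ (allV (m * m)) (λ y → Z y + Z′ y) ∎
        where open ≤-Reasoning

      -- Moves of a state class may end anywhere in `Y`, so each of the `P * P` classes costs a full
      -- `ΣY` per direction.
      ∑-state-share : ∑ (allV (m * m)) (λ x → X x * state-share x) ≤ P * P * (Λ * (2 * ΣY))
      ∑-state-share = begin
        ∑ (allV (m * m)) (λ x → X x * state-share x)
          ≡⟨ ∑-cong (allV (m * m)) (λ x → ∑-*ˡ states (X x) (λ (a , k) → both (Expansion.state P θ a k) x)) ⟨
        ∑ (allV (m * m)) (λ x → ∑ states (λ (a , k) → X x * both (Expansion.state P θ a k) x))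
          ≡⟨ ∑-swap (allV (m * m)) states (λ x (a , k) → X x * both (Expansion.state P θ a k) x) ⟩
        ∑ states (λ (a , k) → ∑ (allV (m * m)) (λ x → X x * both (Expansion.state P θ a k) x))
          ≤⟨ ∑-mono states (λ (a , k) → ∑-both (Expansion.state P θ a k) Y Y (reach-up (Expansion.state P θ a k)) (reach-down (Expansion.state P θ a k))) ⟩
        ∑ states (λ _ → Λ * ∑ (allV (m * m)) (λ y → Y y + Y y))
          ≡⟨ trans (∑-cartesianProductWith _,_ (upTo P) (upTo P) (λ _ → E))
             (trans (∑-const (upTo P) (∑ (upTo P) (λ _ → E)))
             (trans (cong₂ _*_ (length-upTo P) (trans (∑-const (upTo P) E) (cong (_* E) (length-upTo P)))) (sym (*-assoc P P E)))) ⟩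
        P * P * (Λ * ∑ (allV (m * m)) (λ y → Y y + Y y))
          ≡⟨ cong (λ e → P * P * (Λ * e)) (trans (∑-+ (allV (m * m)) Y Y) (cong (ΣY +_) (sym (+-identityʳ ΣY)))) ⟩
        P * P * (Λ * (2 * ΣY)) ∎
        where
        open ≤-Reasoning
        E = Λ * ∑ (allV (m * m)) (λ y → Y y + Y y)

      -- `Y` restricted to the levels that a crossing can hit. Comparing `Φ y` with `R ∸ s` instead
      -- would send every `s ≥ R` to level 0 and spoil disjointness.
      above below : ℕ → V (m * m) → ℕ
      above s y = Y y * ι (Φ y ≡ᵇ R + s)
      below s y = Y y * ι (Φ y + s ≡ᵇ R)

      private
        -- Where `X` vanishes nothing has to be shown, so the target's level may be computed for
        -- points with `Φ x ≡ R` only.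
        on-target : ∀ {a b} {t : Bool} → a ≤ b → (0 < a → t ≡ true) → a ≤ b * ι t
        on-target {zero}  a≤b target = z≤n
        on-target {suc a} {b} a≤b target rewrite target (s≤s z≤n) = ≤-trans a≤b (≤-reflexive (sym (*-identityʳ b)))

      crossing-above : ∀ s x p → up (crossing P θ T s) x p ≡ true → X x ≤ above s (flip x p)
      crossing-above s x p@(i , j) eq = on-target (reach-up (crossing P θ T s) x p eq) λ 0<X →
        ≡ᵇ-yes {Φ (flip x p)} (trans (Φ-flip-up x (proj₂ (W-up (crossing P θ T s) x i j eq)))
          (cong₂ _+_ (on-level x 0<X) (≡ᵇ-true {h (wt x i)} (proj₂ (∧-true {W i j ∧ not (bit x i j)} eq)))))

      -- The downward move reverses the upward move from `flip x p`, so `Φ-flip-up` is applied at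
      -- that lower end.
      crossing-below : ∀ s x p → down (crossing P θ T s) x p ≡ true → X x ≤ below s (flip x p)
      crossing-below s x p@(i , j) eq = on-target (reach-down (crossing P θ T s) x p eq) λ 0<X →
        ≡ᵇ-yes {Φ (flip x p) + s} (trans (cong (Φ (flip x p) +_) (sym (≡ᵇ-true {h (wt (flip x p) i)} (proj₂ (∧-true {W i j ∧ not (bit (flip x p) i j)} eq′)))))
          (trans (sym (Φ-flip-up (flip x p) (proj₂ (W-up (crossing P θ T s) (flip x p) i j eq′))))
            (trans (cong Φ (flip-flip x p)) (on-level x 0<X))))
        where
        eq′ : up (crossing P θ T s) (flip x p) p ≡ true
        eq′ = trans (up-flip (crossing P θ T s) x p) eq

      -- Different increments and directions hit different levels, so all `2 * T` families of moves
      -- together cost a single `ΣY`. This is where the gain of a factor `T` comes from.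
      ∑-crossing-share : ∑ (allV (m * m)) (λ x → X x * crossing-share x) ≤ Λ * ΣY
      ∑-crossing-share = begin
        ∑ (allV (m * m)) (λ x → X x * crossing-share x)
          ≡⟨ ∑-cong (allV (m * m)) (λ x → ∑-*ˡ (upTo T) (X x) (λ s → both (crossing P θ T (suc s)) x)) ⟨
        ∑ (allV (m * m)) (λ x → ∑ (upTo T) (λ s → X x * both (crossing P θ T (suc s)) x))
          ≡⟨ ∑-swap (allV (m * m)) (upTo T) (λ x s → X x * both (crossing P θ T (suc s)) x) ⟩
        ∑ (upTo T) (λ s → ∑ (allV (m * m)) (λ x → X x * both (crossing P θ T (suc s)) x))
          ≤⟨ ∑-mono (upTo T) (λ s → ∑-both (crossing P θ T (suc s)) (above (suc s)) (below (suc s)) (crossing-above (suc s)) (crossing-below (suc s))) ⟩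
        ∑ (upTo T) (λ s → Λ * ∑ (allV (m * m)) (λ y → above (suc s) y + below (suc s) y))
          ≡⟨ ∑-*ˡ (upTo T) Λ (λ s → ∑ (allV (m * m)) (λ y → above (suc s) y + below (suc s) y)) ⟩
        Λ * ∑ (upTo T) (λ s → ∑ (allV (m * m)) (λ y → above (suc s) y + below (suc s) y))
          ≡⟨ cong (Λ *_) (∑-swap (upTo T) (allV (m * m)) (λ s y → above (suc s) y + below (suc s) y)) ⟩
        Λ * ∑ (allV (m * m)) (λ y → ∑ (upTo T) (λ s → above (suc s) y + below (suc s) y))
          ≤⟨ *-monoʳ-≤ Λ (∑-mono (allV (m * m)) one-target) ⟩
        Λ * ΣY ∎
        where
        open ≤-Reasoning
        one-target : ∀ y → ∑ (upTo T) (λ s → above (suc s) y + below (suc s) y) ≤ Y y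
        one-target y = begin
          ∑ (upTo T) (λ s → above (suc s) y + below (suc s) y)
            ≡⟨ ∑-cong (upTo T) (λ s → *-distribˡ-+ (Y y) (ι (Φ y ≡ᵇ R + suc s)) (ι (Φ y + suc s ≡ᵇ R))) ⟨
          ∑ (upTo T) (λ s → Y y * (ι (Φ y ≡ᵇ R + suc s) + ι (Φ y + suc s ≡ᵇ R)))
            ≡⟨ ∑-*ˡ (upTo T) (Y y) (λ s → ι (Φ y ≡ᵇ R + suc s) + ι (Φ y + suc s ≡ᵇ R)) ⟩
          Y y * ∑ (upTo T) (λ s → ι (Φ y ≡ᵇ R + suc s) + ι (Φ y + suc s ≡ᵇ R))
            ≤⟨ *-monoʳ-≤ (Y y) (shifted-level T (Φ y) R) ⟩
          Y y * 1
            ≡⟨ *-identityʳ (Y y) ⟩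
          Y y ∎

      -- The coefficients bring both alternatives of `large-share` to the same lower bound
      -- `P * P * T * Λ`.
      combined : V (m * m) → ℕ
      combined x = state-share x + P * P * (2 * crossing-share x)

      combined-large : ∀ x → P * P * T * Λ ≤ combined x
      combined-large x with large-share T≤P many x
      ... | inj₁ large = ≤-trans large (m≤m+n (state-share x) _)
      ... | inj₂ large = ≤-trans (≤-reflexive (*-assoc (P * P) T Λ)) (≤-trans (*-monoʳ-≤ (P * P) large) (m≤n+m _ (state-share x)))

      -- Sum `combined` against `X`. Of the 4, two come from the two directions of the state classes
      -- and two from the half shares of the crossings.
      expansion : T * ΣX ≤ 4 * ΣY
      expansion = *-cancelˡ-≤ (P * P * Λ) {{m*n≢0 (P * P) Λ {{PP≢0}} {{>-nonZero 0<Λ}}}} (begin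
        P * P * Λ * (T * ΣX)                               ≡⟨ lhs ⟩
        ΣX * (P * P * T * Λ)                               ≡⟨ ∑-*ʳ (allV (m * m)) (P * P * T * Λ) X ⟨
        ∑ (allV (m * m)) (λ x → X x * (P * P * T * Λ))     ≤⟨ ∑-mono (allV (m * m)) (λ x → *-monoʳ-≤ (X x) (combined-large x)) ⟩
        ∑ (allV (m * m)) (λ x → X x * combined x)          ≡⟨ ∑-cong (allV (m * m)) (λ x → split (X x) (state-share x) (P * P) (crossing-share x)) ⟩
        ∑ (allV (m * m)) (λ x → X x * state-share x + P * P * 2 * (X x * crossing-share x))
          ≡⟨ ∑-+ (allV (m * m)) (λ x → X x * state-share x) (λ x → P * P * 2 * (X x * crossing-share x)) ⟩
        ∑ (allV (m * m)) (λ x → X x * state-share x) + ∑ (allV (m * m)) (λ x → P * P * 2 * (X x * crossing-share x))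
          ≡⟨ cong (∑ (allV (m * m)) (λ x → X x * state-share x) +_) (∑-*ˡ (allV (m * m)) (P * P * 2) (λ x → X x * crossing-share x)) ⟩
        ∑ (allV (m * m)) (λ x → X x * state-share x) + P * P * 2 * ∑ (allV (m * m)) (λ x → X x * crossing-share x)
          ≤⟨ +-mono-≤ ∑-state-share (*-monoʳ-≤ (P * P * 2) ∑-crossing-share) ⟩
        P * P * (Λ * (2 * ΣY)) + P * P * 2 * (Λ * ΣY)      ≡⟨ rhs (P * P) Λ ΣY ⟩
        P * P * Λ * (4 * ΣY)                               ∎)
        where
        open ≤-Reasoning
        open import Data.Nat.Solver using (module +-*-Solver)
        open +-*-Solver
        lhs : P * P * Λ * (T * ΣX) ≡ ΣX * (P * P * T * Λ)
        lhs = solve 4 (λ p l t x → p :* l :* (t :* x) := x :* (p :* t :* l)) refl (P * P) Λ T ΣX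
        split : ∀ x s p c → x * (s + p * (2 * c)) ≡ x * s + p * 2 * (x * c)
        split = solve 4 (λ x s p c → x :* (s :+ p :* (con 2 :* c)) := x :* s :+ p :* con 2 :* (x :* c)) refl
        rhs : ∀ p l y → p * (l * (2 * y)) + p * 2 * (l * y) ≡ p * l * (4 * y)
        rhs = solve 3 (λ p l y → p :* (l :* (con 2 :* y)) :+ p :* con 2 :* (l :* y) := p :* l :* (con 4 :* y)) refl

-- The construction of `A` and `B`, and the bound on `B′`.

module Core where

  open import Data.Bool as Bool using (Bool; true; false)
  open import Data.Fin using (Fin; zero; suc)
  open import Data.Nat
  open import Data.Nat.Properties
  open import Data.List using (List; allFin; map; filter; length; cartesianProduct)
  open import Data.List.Properties using (map-tabulate; length-map; length-tabulate)
  open import Data.List.Membership.Propositional using (_∈_)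
  open import Data.List.Membership.Propositional.Properties
    using (∈-filter⁺; ∈-filter⁻; ∈-map⁻; ∈-cartesianProductWith⁺; ∈-deduplicate⁺)
  open import Data.List.Relation.Unary.All as All using (All)
  open import Data.List.Relation.Unary.Unique.Propositional using (Unique)
  open import Data.List.Relation.Unary.Unique.Propositional.Properties using (allFin⁺; map⁺; filter⁺; cartesianProduct⁺)
  open import Data.Product using (Σ; ∃-syntax; _×_; _,_; proj₁; proj₂)
  open import Function using (_∘_; id; it)
  open import Relation.Binary.PropositionalEquality
  open import Relation.Nullary using (Dec; does; yes; no; ¬_; contradiction)
  open import Defs using (V; _⊕_; _∈?_; _⊆_; _≟V_; sumset; goodPairs)
  open Sums
  open Cube
  open LevelSet using (cells; length-cells; ι-yes; ι-no; module Averaging; module Residues)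
  open Chain using (β)

  ∑-allFin-suc : ∀ n (f : Fin (suc n) → ℕ) → ∑ (allFin (suc n)) f ≡ f zero + ∑ (allFin n) (f ∘ suc)
  ∑-allFin-suc n f = cong (f zero +_)
    (trans (cong (λ xs → ∑ xs f) (sym (map-tabulate {n = n} id suc))) (∑-map suc (allFin n) f))

  select : ∀ {n} (f : Fin n → Bool) P → P ≤ ∑ (allFin n) (λ j → ι (f j)) →
           Σ (Fin n → Bool) λ w → (∀ j → w j ≡ true → f j ≡ true) × ∑ (allFin n) (λ j → ι (w j)) ≡ P
  select {n}     f zero    _  = (λ _ → false) , (λ _ ()) , ∑-zero (allFin n)
  select {suc n} f (suc P) P≤ with f zero in f0 | subst (suc P ≤_) (∑-allFin-suc n (λ j → ι (f j))) P≤
  ... | true | s≤s P≤′ with select (f ∘ suc) P P≤′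
  ...   | w , w⊆f , Σw = w′ , w′⊆f , trans (∑-allFin-suc n (λ j → ι (w′ j))) (cong suc Σw)
    where
    w′ : Fin (suc n) → Bool
    w′ zero    = true
    w′ (suc j) = w j
    w′⊆f : ∀ j → w′ j ≡ true → f j ≡ true
    w′⊆f zero    _ = f0
    w′⊆f (suc j)   = w⊆f j
  select {suc n} f (suc P) P≤ | false | P≤′ with select (f ∘ suc) (suc P) P≤′
  ...   | w , w⊆f , Σw = w′ , w′⊆f , trans (∑-allFin-suc n (λ j → ι (w′ j))) Σw
    where
    w′ : Fin (suc n) → Bool
    w′ zero    = false
    w′ (suc j) = w j
    w′⊆f : ∀ j → w′ j ≡ true → f j ≡ true
    w′⊆f (suc j) = w⊆f j

  -- A row with fewer than `P` marks is emptied, any other is cut down to `P`. The last bound is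
  -- what makes a large `B′` force many selected rows.
  select-row : ∀ {n} (f : Fin n → Bool) P →
    Σ (Fin n → Bool) λ w → Σ Bool λ s → (∀ j → w j ≡ true → f j ≡ true) × ∑ (allFin n) (λ j → ι (w j)) ≡ ι s * P
                × ∑ (allFin n) (λ j → ι (f j)) ≤ P + ι s * n
  select-row {n} f P with P ≤? ∑ (allFin n) (λ j → ι (f j))
  ... | no  P≰ = (λ _ → false) , false , (λ _ ()) , ∑-zero (allFin n) , ≤-trans (<⇒≤ (≰⇒> P≰)) (m≤m+n P 0)
  ... | yes P≤ with select f P P≤
  ...   | w , w⊆f , Σw = w , true , w⊆f , trans Σw (sym (*-identityˡ P)) , (begin
      ∑ (allFin n) (λ j → ι (f j)) ≤⟨ ∑-mono (allFin n) (λ j → ι≤1 (f j)) ⟩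
      ∑ (allFin n) (λ _ → 1)       ≡⟨ ∑-const (allFin n) 1 ⟩
      length (allFin n) * 1        ≡⟨ cong (_* 1) (length-tabulate {n = n} id) ⟩
      n * 1                        ≡⟨ *-comm n 1 ⟩
      1 * n                        ≤⟨ m≤n+m (1 * n) P ⟩
      P + 1 * n                    ∎)
    where open ≤-Reasoning

  ∑-∈?≤ : ∀ {n} (zs xs : List (V n)) → Unique zs → ∑ zs (λ x → ι (does (x ∈? xs))) ≤ length xs
  ∑-∈?≤ zs xs uzs = ≤-trans (≤-reflexive (sym (length-filter≡∑ (_∈? xs) zs)))
    (Unique-⊆⇒length≤ (filter⁺ (_∈? xs) uzs) (λ x∈ → proj₂ (∈-filter⁻ (_∈? xs) {xs = zs} x∈)))

  length≤∑-∈? : ∀ {n} (zs xs : List (V n)) → Unique xs → xs ⊆ zs → length xs ≤ ∑ zs (λ x → ι (does (x ∈? xs)))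
  length≤∑-∈? zs xs uxs xs⊆ = ≤-trans
    (Unique-⊆⇒length≤ uxs (λ x∈ → ∈-filter⁺ (_∈? xs) (All.lookup xs⊆ x∈) x∈))
    (≤-reflexive (length-filter≡∑ (_∈? xs) zs))

  -- For fixed `x` the vectors `x ⊕ b` are distinct, so at most `length A` of them lie in `A`.
  goodPairs≤ : ∀ {n} (A B : List (V n)) → Unique B → goodPairs A B ≤ length A * length A
  goodPairs≤ A B uB = begin
    goodPairs A B
      ≡⟨ length-filter≡∑ (λ p → (proj₁ p ⊕ proj₂ p) ∈? A) (cartesianProduct A B) ⟩
    ∑ (cartesianProduct A B) (λ p → ι (does ((proj₁ p ⊕ proj₂ p) ∈? A)))
      ≡⟨ ∑-cartesianProductWith _,_ A B _ ⟩
    ∑ A (λ x → ∑ B (λ b → ι (does ((x ⊕ b) ∈? A))))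
      ≤⟨ ∑-mono A (λ x → ≤-trans (≤-reflexive (sym (∑-map (x ⊕_) B (λ y → ι (does (y ∈? A))))))
                                  (∑-∈?≤ (map (x ⊕_) B) A (map⁺ (⊕-cancelˡ x) uB))) ⟩
    ∑ A (λ _ → length A)
      ≡⟨ ∑-const A (length A) ⟩
    length A * length A ∎
    where open ≤-Reasoning

  ι-pos : ∀ {A : Set} (d : Dec A) → 0 < ι (does d) → A
  ι-pos (yes a) _ = a

  -- For `a = |A|` and `b = |B|`. As `a * b ≤ d * (a * b)`, half of the left side absorbs the last
  -- term.
  many-neighbours : ∀ d a b .{{_ : NonZero d}} → 0 < a → 2 * d * (a * b) ≤ 2 * d * (a * a) + a * b → b ≤ 2 * a
  many-neighbours d a b 0<a le = *-cancelˡ-≤ d (+-cancelˡ-≤ (d * b) _ _ (*-cancelˡ-≤ a {{>-nonZero 0<a}} (begin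
    a * (d * b + d * b)                ≡⟨ solve 3 (λ a b d → a :* (d :* b :+ d :* b) := con 2 :* d :* (a :* b)) refl a b d ⟩
    2 * d * (a * b)                    ≤⟨ le ⟩
    2 * d * (a * a) + a * b            ≤⟨ +-monoʳ-≤ (2 * d * (a * a)) (*-monoʳ-≤ a (m≤n*m b d)) ⟩
    2 * d * (a * a) + a * (d * b)      ≡⟨ solve 3 (λ a b d → con 2 :* d :* (a :* a) :+ a :* (d :* b) := a :* (d :* b :+ d :* (con 2 :* a))) refl a b d ⟩
    a * (d * b + d * (2 * a))          ∎)))
    where
    open ≤-Reasoning
    open import Data.Nat.Solver using (module +-*-Solver)
    open +-*-Solver

  -- The theorem over ℕ: `1 / d` stands for `δ`, a strict bound by `K₁` for the bound by `K`, and
  -- squaring removes the square root.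
  AlmostInvariantPair : (d K₁ C N : ℕ) → Set
  AlmostInvariantPair d K₁ C N =
    Σ ℕ λ n → Σ (List (V n)) λ A → Σ (List (V n)) λ B →
      Unique A × Unique B × N ≤ length A × N ≤ length B ×
      d * (length A * length B) ≤ d * goodPairs A B + length A * length B ×
      ((A′ B′ : List (V n)) → Unique A′ → Unique B′ → A′ ⊆ A → B′ ⊆ B →
        length (sumset A′ B′) < K₁ * length A′ → length B′ * length B′ ≤ C * C * length B)

  module Constants (K₁ M : ℕ) .{{_ : NonZero K₁}} .{{_ : NonZero M}} where

    -- `T` absorbs the 4 of `expansion`, and `s₀` is the number of selected rows that `pigeonhole`
    -- asks for. With fewer of them, `B′` has at most `(P + s₀) * m` elements. None of the constants
    -- involves `m`.
    T P s₀ C : ℕ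
    T  = 4 * K₁
    P  = M * T
    s₀ = P * suc P * β P (P * P * T * P) P
    C  = P + s₀

    T≢0 : NonZero T
    T≢0 = m*n≢0 4 K₁

    P≢0 : NonZero P
    P≢0 = m*n≢0 M T {{it}} {{T≢0}}

  module Construction (K₁ M m : ℕ) .{{_ : NonZero K₁}} .{{_ : NonZero M}} where

    open Constants K₁ M
    open Grid m

    private instance
      T-nonZero : NonZero T
      T-nonZero = T≢0
      P-nonZero : NonZero P
      P-nonZero = P≢0

    open Residues m M T

    module _ (θ R : ℕ) (A′ B′ : List (V (m * m))) (uA′ : Unique A′) (uB′ : Unique B′)
             (A′⊆ : A′ ⊆ level θ R) (B′⊆ : B′ ⊆ B) where

      b : Fin m → Fin m → Bool
      b i j = does (unit (i , j) ∈? B′)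

      b-true : ∀ i j → b i j ≡ true → unit (i , j) ∈ B′
      b-true i j eq = ι-pos (unit (i , j) ∈? B′) (≤-reflexive (cong ι (sym eq)))

      W : Fin m → Fin m → Bool
      W i = proj₁ (select-row (b i) P)

      S : Fin m → Bool
      S i = proj₁ (proj₂ (select-row (b i) P))

      length-B′≤ : length B′ ≤ (P + ∑ (allFin m) (λ i → ι (S i))) * m
      length-B′≤ = begin
        length B′                                       ≤⟨ length≤∑-∈? B B′ uB′ B′⊆ ⟩
        ∑ B (λ x → ι (does (x ∈? B′)))                  ≡⟨ ∑-map unit (cells m) (λ x → ι (does (x ∈? B′))) ⟩
        ∑ (cells m) (λ p → ι (does (unit p ∈? B′)))     ≡⟨ ∑-cartesianProductWith _,_ (allFin m) (allFin m) (λ p → ι (does (unit p ∈? B′))) ⟩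
        ∑ (allFin m) (λ i → ∑ (allFin m) (λ j → ι (b i j)))
          ≤⟨ ∑-mono (allFin m) (λ i → proj₂ (proj₂ (proj₂ (proj₂ (select-row (b i) P))))) ⟩
        ∑ (allFin m) (λ i → P + ι (S i) * m)            ≡⟨ ∑-+ (allFin m) (λ _ → P) (λ i → ι (S i) * m) ⟩
        ∑ (allFin m) (λ _ → P) + ∑ (allFin m) (λ i → ι (S i) * m)
          ≡⟨ cong₂ _+_ (trans (∑-const (allFin m) P) (trans (cong (_* P) (length-tabulate {n = m} id)) (*-comm m P)))
                       (∑-*ʳ (allFin m) m (λ i → ι (S i))) ⟩
        P * m + ∑ (allFin m) (λ i → ι (S i)) * m        ≡⟨ *-distribʳ-+ m P (∑ (allFin m) (λ i → ι (S i))) ⟨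
        (P + ∑ (allFin m) (λ i → ι (S i))) * m          ∎
        where open ≤-Reasoning

      module _ (many : s₀ ≤ ∑ (allFin m) (λ i → ι (S i))) where

        X Y : V (m * m) → ℕ
        X x = ι (does (x ∈? A′))
        Y y = ι (does (y ∈? sumset A′ B′))

        X-level : ∀ x → 0 < X x → Φ θ x ≡ R
        X-level x 0<X = proj₂ (∈-filter⁻ (λ x → Φ θ x ≟ R) {xs = allV (m * m)}
          (All.lookup A′⊆ (ι-pos (x ∈? A′) 0<X)))

        X-reach : ∀ x i j → W i j ≡ true → X x ≤ Y (flip x (i , j))
        X-reach x i j wij with x ∈? A′
        ... | no  _  = z≤n
        ... | yes x∈ = ≤-reflexive (sym (ι-yes (flip x (i , j) ∈? sumset A′ B′) (∈-deduplicate⁺ _≟V_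
            (∈-cartesianProductWith⁺ _⊕_ x∈ (b-true i j (proj₁ (proj₂ (proj₂ (select-row (b i) P))) j wij))))))

        K₁|A′|≤|A′+B′| : K₁ * length A′ ≤ length (sumset A′ B′)
        K₁|A′|≤|A′+B′| = *-cancelˡ-≤ 4 (begin
          4 * (K₁ * length A′)            ≡⟨ *-assoc 4 K₁ (length A′) ⟨
          T * length A′                   ≤⟨ *-monoʳ-≤ T (length≤∑-∈? (allV (m * m)) A′ uA′ (All.tabulate (λ {x} _ → ∈-allV x))) ⟩
          T * ∑ (allV (m * m)) X          ≤⟨ Boundary.expansion m P T θ R (m≤n*m T M) W S
                                               (λ i → proj₁ (proj₂ (proj₂ (proj₂ (select-row (b i) P))))) many X Y X-level X-reach ⟩
          4 * ∑ (allV (m * m)) Y          ≤⟨ *-monoʳ-≤ 4 (∑-∈?≤ (allV (m * m)) (sumset A′ B′) (allV-unique (m * m))) ⟩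
          4 * length (sumset A′ B′)       ∎)
          where open ≤-Reasoning

      -- With `s₀` selected rows the sumset would be too large. So there are fewer, and `length-B′≤`
      -- gives `C * m`, where `m` is the square root of `length B`.
      small-sumset : length (sumset A′ B′) < K₁ * length A′ → length B′ ≤ C * m
      small-sumset small with s₀ ≤? ∑ (allFin m) (λ i → ι (S i))
      ... | yes many = contradiction (K₁|A′|≤|A′+B′| many) (<⇒≱ small)
      ... | no  few  = ≤-trans length-B′≤ (*-monoˡ-≤ m (+-monoʳ-≤ P (<⇒≤ (≰⇒> few))))

    B-unique : Unique B
    B-unique = map⁺ unit-injective (cartesianProduct⁺ (allFin⁺ m) (allFin⁺ m))

    level-unique : ∀ θ R → Unique (level θ R)
    level-unique θ R = filter⁺ (λ x → Φ θ x ≟ R) (allV-unique (m * m))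

    length-B : length B ≡ m * m
    length-B = trans (length-map unit (cells m)) (length-cells m)

    almost-invariant : 0 < m → ∃[ θ ] ∃[ R ] 0 < length (level θ R)
      × M * (length (level θ R) * length B) ≤ M * goodPairs (level θ R) B + length (level θ R) * length B
    almost-invariant 0<m = subst
      (λ N → ∃[ θ ] ∃[ R ] 0 < length (level θ R)
        × M * (length (level θ R) * N) ≤ M * goodPairs (level θ R) B + length (level θ R) * N)
      (sym (length-map unit (cells m)))
      (level-almost-invariant ∑-changed≤ (>-nonZero⁻¹ P)
        (subst (0 <_) (sym (length-cells m)) (*-mono-≤ 0<m 0<m)))

    module _ (d : ℕ) .{{_ : NonZero d}} (M≡2d : M ≡ 2 * d) (θ R : ℕ) (0<A : 0 < length (level θ R))
             (good : M * (length (level θ R) * length B) ≤ M * goodPairs (level θ R) B + length (level θ R) * length B)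
             where

      open ≤-Reasoning

      A : List (V (m * m))
      A = level θ R

      good′ : 2 * d * (length A * length B) ≤ 2 * d * goodPairs A B + length A * length B
      good′ = subst (λ M → M * (length A * length B) ≤ M * goodPairs A B + length A * length B) M≡2d good

      density : d * (length A * length B) ≤ d * goodPairs A B + length A * length B
      density = *-cancelˡ-≤ 2 (begin
        2 * (d * (length A * length B))                       ≡⟨ *-assoc 2 d _ ⟨
        2 * d * (length A * length B)                         ≤⟨ good′ ⟩
        2 * d * goodPairs A B + length A * length B           ≤⟨ +-monoʳ-≤ (2 * d * goodPairs A B) (m≤n*m _ 2) ⟩
        2 * d * goodPairs A B + 2 * (length A * length B)     ≡⟨ cong (_+ 2 * (length A * length B)) (*-assoc 2 d (goodPairs A B)) ⟩
        2 * (d * goodPairs A B) + 2 * (length A * length B)   ≡⟨ *-distribˡ-+ 2 (d * goodPairs A B) (length A * length B) ⟨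
        2 * (d * goodPairs A B + length A * length B)         ∎)

      -- Taking `M = 2 * d` guarantees that at least half of the pairs are good even for `d = 1`.
      -- Hence `A` cannot be much smaller than `B`, which is how `A` is made large.
      |B|≤2|A| : length B ≤ 2 * length A
      |B|≤2|A| = many-neighbours d (length A) (length B) 0<A (begin
        2 * d * (length A * length B)                         ≤⟨ good′ ⟩
        2 * d * goodPairs A B + length A * length B           ≤⟨ +-monoˡ-≤ _ (*-monoʳ-≤ (2 * d) (goodPairs≤ A B B-unique)) ⟩
        2 * d * (length A * length A) + length A * length B   ∎)

      small : (A′ B′ : List (V (m * m))) → Unique A′ → Unique B′ → A′ ⊆ A → B′ ⊆ B →
              length (sumset A′ B′) < K₁ * length A′ → length B′ * length B′ ≤ C * C * length B
      small A′ B′ uA′ uB′ A′⊆ B′⊆ lt = begin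
        length B′ * length B′   ≤⟨ *-mono-≤ le le ⟩
        C * m * (C * m)         ≡⟨ interchange C m C m ⟩
        C * C * (m * m)         ≡⟨ cong (C * C *_) length-B ⟨
        C * C * length B        ∎
        where
        open import Algebra.Properties.CommutativeSemigroup *-commutativeSemigroup using (interchange)
        le : length B′ ≤ C * m
        le = small-sumset θ R A′ B′ uA′ uB′ A′⊆ B′⊆ lt

      pair : ∀ N → 2 * N ≤ m → AlmostInvariantPair d K₁ C N
      pair N 2N≤m = m * m , A , B , level-unique θ R , B-unique
        , *-cancelˡ-≤ 2 (≤-trans 2N≤|B| |B|≤2|A|) , ≤-trans (m≤m+n N (N + 0)) 2N≤|B| , density , small
        where
        2N≤|B| : 2 * N ≤ length B
        2N≤|B| = subst (2 * N ≤_) (sym length-B) (≤-trans 2N≤m (m≤m*m m))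
          where
          m≤m*m : ∀ m → m ≤ m * m
          m≤m*m zero    = z≤n
          m≤m*m (suc m) = m≤m*n (suc m) (suc m)

  almost-invariant-pairs : (K₁ d : ℕ) .{{_ : NonZero K₁}} .{{_ : NonZero d}} →
                           Σ ℕ λ C → (N : ℕ) → AlmostInvariantPair d K₁ C N
  almost-invariant-pairs K₁ d = Constants.C K₁ (2 * d) {{it}} {{M≢0}} , λ N →
    -- The side `m = suc (2 * N)` is positive and gives `length B = m * m ≥ 2 * N`, hence at least
    -- `N` elements in both sets.
    from-level N (Construction.almost-invariant K₁ (2 * d) (suc (2 * N)) {{it}} {{M≢0}} (s≤s z≤n))
    where
    M≢0 : NonZero (2 * d)
    M≢0 = m*n≢0 2 d
    from-level : ∀ N → _ → AlmostInvariantPair d K₁ (Constants.C K₁ (2 * d) {{it}} {{M≢0}}) N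
    from-level N (θ , R , 0<A , good) =
      Construction.pair K₁ (2 * d) (suc (2 * N)) {{it}} {{M≢0}} d refl θ R 0<A good N (n≤1+n (2 * N))

-- Translation between rational and natural inequalities.

module Rationals where

  open import Data.Integer as ℤ using (+_; -[1+_])
  import Data.Integer.Properties as ℤP
  open import Data.Nat as ℕ using (zero; suc)
  import Data.Nat.Properties as ℕP
  open import Data.Nat.Coprimality using (sym; 1-coprimeTo)
  open import Data.Rational
  open import Data.Rational.Properties
  import Data.Rational.Unnormalised as ℚᵘ
  import Data.Rational.Unnormalised.Properties as ℚᵘP
  open import Relation.Binary.PropositionalEquality hiding (sym)
  open import Defs using (ℕ→ℚ)

  -- A fraction with denominator 1 is already reduced, but the normalisation in `/` does not compute
  -- on a variable numerator.
  ℕ→ℚ-toℚᵘ : ∀ a → toℚᵘ (ℕ→ℚ a) ≡ ℚᵘ.mkℚᵘ (+ a) 0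
  ℕ→ℚ-toℚᵘ a = cong toℚᵘ (normalize-coprime {a} {0} (sym (1-coprimeTo a)))

  -- The denominator of `K` is at least 1, so `K` is at most the absolute value of its numerator.
  ≤-scaled : ∀ K y a → ℕ→ℚ y ≤ K * ℕ→ℚ a → y ℕ.≤ ℤ.∣ ↥ K ∣ ℕ.* a
  ≤-scaled K y a le with ℚᵘP.≤-respʳ-≃ (toℚᵘ-homo-* K (ℕ→ℚ a)) (toℚᵘ-mono-≤ le)
  ... | le′ rewrite ℕ→ℚ-toℚᵘ y | ℕ→ℚ-toℚᵘ a with ℚᵘP.drop-*≤* le′
  ... | z = ℕP.≤-trans (ℕP.m≤m*n y (suc (ℚᵘ.ℚᵘ.denominator-1 (toℚᵘ K ℚᵘ.* ℚᵘ.mkℚᵘ (+ a) 0)))) (ℤP.drop‿+≤+ (begin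
    + (y ℕ.* suc _)                ≡⟨ ℤP.pos-* y _ ⟩
    + y ℤ.* + suc _                ≤⟨ z ⟩
    ℚᵘ.↥ (toℚᵘ K ℚᵘ.* ℚᵘ.mkℚᵘ (+ a) 0) ℤ.* ℤ.1ℤ ≡⟨ ℤP.*-identityʳ _ ⟩
    ℚᵘ.↥ (toℚᵘ K ℚᵘ.* ℚᵘ.mkℚᵘ (+ a) 0) ≡⟨ numerator K ⟩
    ↥ K ℤ.* + a                    ≤⟨ i≤∣i∣ (↥ K ℤ.* + a) ⟩
    + ℤ.∣ ↥ K ℤ.* + a ∣            ≡⟨ cong +_ (ℤP.abs-* (↥ K) (+ a)) ⟩
    + (ℤ.∣ ↥ K ∣ ℕ.* a)            ∎))
    where
    open ℤP.≤-Reasoning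
    numerator : ∀ K → ℚᵘ.↥ (toℚᵘ K ℚᵘ.* ℚᵘ.mkℚᵘ (+ a) 0) ≡ ↥ K ℤ.* + a
    numerator (mkℚ _ _ _) = refl
    i≤∣i∣ : ∀ i → i ℤ.≤ + ℤ.∣ i ∣
    i≤∣i∣ (+ n)    = ℤP.≤-refl
    i≤∣i∣ -[1+ n ] = ℤ.-≤+

  -- A positive `δ` has numerator at least 1, so `δ ≥ 1 / ↧ₙ δ` and the density `1 - 1 / ↧ₙ δ`
  -- suffices.
  1-δ-scaled : ∀ δ → 0ℚ < δ → ∀ x g → ↧ₙ δ ℕ.* x ℕ.≤ ↧ₙ δ ℕ.* g ℕ.+ x → (1ℚ - δ) * ℕ→ℚ x ≤ ℕ→ℚ g
  1-δ-scaled (mkℚ (+ zero) d _)  (*<* (ℤ.+<+ ()))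
  1-δ-scaled (mkℚ -[1+ n ] d _)  (*<* ())
  1-δ-scaled δ@(mkℚ (+ suc n) d _) 0<δ x g le = toℚᵘ-cancel-≤
    (ℚᵘP.≤-respˡ-≃ (ℚᵘP.≃-sym (ℚᵘP.≃-trans (toℚᵘ-homo-* (1ℚ - δ) (ℕ→ℚ x))
        (ℚᵘP.*-congʳ (ℚᵘP.≃-trans (toℚᵘ-homo-+ 1ℚ (- δ)) (ℚᵘP.+-congʳ ℚᵘ.1ℚᵘ (toℚᵘ-homo‿- δ)))))) unnormalised)
    where
    unnormalised : ((ℚᵘ.1ℚᵘ ℚᵘ.- toℚᵘ δ) ℚᵘ.* toℚᵘ (ℕ→ℚ x)) ℚᵘ.≤ toℚᵘ (ℕ→ℚ g)
    unnormalised rewrite ℕ→ℚ-toℚᵘ x | ℕ→ℚ-toℚᵘ g = ℚᵘ.*≤* (begin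
      (ℤ.1ℤ ℤ.* + suc d ℤ.+ ℤ.- (+ suc n) ℤ.* ℤ.1ℤ) ℤ.* + x ℤ.* ℤ.1ℤ
        ≡⟨ solve 3 (λ d n x → (con ℤ.1ℤ :* d :+ :- n :* con ℤ.1ℤ) :* x :* con ℤ.1ℤ := d :* x :- n :* x) refl (+ suc d) (+ suc n) (+ x) ⟩
      + suc d ℤ.* + x ℤ.- + suc n ℤ.* + x
        ≤⟨ ℤP.+-monoˡ-≤ (ℤ.- (+ suc n ℤ.* + x)) scaled ⟩
      + suc d ℤ.* + g ℤ.+ + suc n ℤ.* + x ℤ.- + suc n ℤ.* + x
        ≡⟨ solve 4 (λ d n x g → d :* g :+ n :* x :- n :* x := g :* d) refl (+ suc d) (+ suc n) (+ x) (+ g) ⟩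
      + g ℤ.* + suc d
        ≡⟨ cong (λ e → + g ℤ.* + suc e) (trans (ℕP.*-identityʳ (d ℕ.+ 0)) (ℕP.+-identityʳ d)) ⟨
      + g ℤ.* + suc ((d ℕ.+ 0) ℕ.* 1) ∎)
      where
      open ℤP.≤-Reasoning
      open import Data.Integer.Solver using (module +-*-Solver)
      open +-*-Solver
      scaled : + suc d ℤ.* + x ℤ.≤ + suc d ℤ.* + g ℤ.+ + suc n ℤ.* + x
      scaled = begin
        + suc d ℤ.* + x                          ≡⟨ ℤP.pos-* (suc d) x ⟨
        + (suc d ℕ.* x)                          ≤⟨ ℤ.+≤+ (ℕP.≤-trans le (ℕP.+-monoʳ-≤ (suc d ℕ.* g) (ℕP.m≤n*m x (suc n)))) ⟩
        + (suc d ℕ.* g ℕ.+ suc n ℕ.* x)          ≡⟨ ℤP.pos-+ (suc d ℕ.* g) (suc n ℕ.* x) ⟩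
        + (suc d ℕ.* g) ℤ.+ + (suc n ℕ.* x)      ≡⟨ cong₂ ℤ._+_ (ℤP.pos-* (suc d) g) (ℤP.pos-* (suc n) x) ⟩
        + suc d ℤ.* + g ℤ.+ + suc n ℤ.* + x      ∎

-- The theorem for rational parameters.

open import Defs
open import Data.Nat using (ℕ; _*_)
import Data.Nat as ℕ
open import Data.Rational using (ℚ; 0ℚ; 1ℚ; _<_; _≤_; _-_) renaming (_*_ to _*ℚ_)
open import Data.List using (List; length)
open import Data.List.Relation.Unary.Unique.Propositional using (Unique)
open import Data.Product using (Σ; _×_; _,_)
import Data.Integer as ℤ
open import Data.Nat.Properties using (+-mono-≤)

theorem1p1 : (δ K : ℚ) → 0ℚ < δ → δ < 1ℚ → 1ℚ < K →
    Σ ℕ λ C → (N : ℕ) →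
    Σ ℕ λ n → Σ (List (V n)) λ A → Σ (List (V n)) λ B →
    Unique A × Unique B × N ℕ.≤ length A × N ℕ.≤ length B ×
    ((1ℚ - δ) *ℚ ℕ→ℚ (length A * length B) ≤ ℕ→ℚ (goodPairs A B)) ×
    ((A' B' : List (V n)) → Unique A' → Unique B' → A' ⊆ A → B' ⊆ B →
    0 ℕ.< length A' →
    ℕ→ℚ (length (sumset A' B')) ≤ K *ℚ ℕ→ℚ (length A') →
    length B' * length B' ℕ.≤ (C * C) * length B)
theorem1p1 δ K 0<δ _ _ = rational (Core.almost-invariant-pairs (ℕ.suc ℤ.∣ ℚ.numerator K ∣) (ℚ.denominatorℕ δ))
  where
  rational : (Σ ℕ λ C → (N : ℕ) → Core.AlmostInvariantPair (ℚ.denominatorℕ δ) (ℕ.suc ℤ.∣ ℚ.numerator K ∣) C N) → _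
  rational (C , pairs) = C , λ N → let n , A , B , uA , uB , N≤A , N≤B , density , small = pairs N in
    n , A , B , uA , uB , N≤A , N≤B
    , Rationals.1-δ-scaled δ 0<δ (length A * length B) (goodPairs A B) density
    -- As `A′` is nonempty, a sumset of size at most `k * length A′` has size less than
    -- `suc k * length A′`; hence the successor in `K₁`.
    , λ A′ B′ uA′ uB′ A′⊆ B′⊆ 0<A′ le → small A′ B′ uA′ uB′ A′⊆ B′⊆
        (+-mono-≤ 0<A′ (Rationals.≤-scaled K (length (sumset A′ B′)) (length A′) le))
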